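{- Let $H=H(Q^1,Q^2,Q^3,Q^4)$ be the cubic graph constructed (as in the context) from cyclically $5$-edge connected permutation snarks $Q^1,\dots,Q^4$ with permutation $2$-factors $F^i$ not contained in any CDC of $Q^i$, and let $F$ be the associated permutation $2$-factor of $H$. If $S$ is a CDC of $H$, then $F\notin S$.
   Context: Basic notions. A circuit is a $2$-regular $2$-connected graph. A CDC of a graph $G$ is a set $S$ of subgraphs of $G$, every component of each of which is a circuit, such that every edge of $G$ lies in exactly two elements of $S$; a $2$-factor is contained in a CDC consisting of circuits if each of its circuits is an element of it (equivalently, there is a CDC in the general sense having the $2$-factor as an element). A cycle permutation graph is a cubic graph with a $2$-factor consisting of two chordless circuits (a permutation $2$-factor). A snark is a cyclically $4$-edge connected cubic graph of girth at least $5$ that is not $3$-edge colorable; a permutation snark is a cycle permutation graph that is a snark. $\lambda_c(G)$ is the minimum number of edges whose deletion yields two components each containing a circuit; cyclically $k$-edge connected means $\lambda_c\ge k$. The graphs $Q^i$ and $\widetilde Q^i$. For $i\in\{1,2,3,4\}$ let $Q^i$ be a cyclically $5$-edge connected permutation snark with a permutation $2$-factor $F^i$, with circuits $C^i_1,C^i_2$, such that $F^i$ is not contained in any CDC of $Q^i$. Label vertices so that $C^i_1$ contains a subpath with consecutive vertices $x^i_1,x^i_2,z^i_2,x^i_6$, and $C^i_2$ contains a subpath with consecutive vertices $x^i_4,z^i_1,x^i_5$, where $z^i_1z^i_2\in E(Q^i)$. Let $\widetilde Q^i$ be obtained from $Q^i$ by removing the edge $x^i_1x^i_2$ and the vertices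 $z^i_1,z^i_2$, and adding new vertices $y^i_1,\dots,y^i_6$ and edges $e^i_3:=x^i_2y^i_3$ and $e^i_s:=x^i_sy^i_s$ for $s=1,2,4,5,6$. The six edges $e^i_j$ together with the remaining edges of $F^i$ induce three paths in $\widetilde Q^i$: $A^i_1$ with end-edges $e^i_1,e^i_6$; $A^i_2$ with end-edges $e^i_4,e^i_5$; $A^i_3$ with end-edges $e^i_2,e^i_3$. Put $A^i:=A^i_1\cup A^i_2\cup A^i_3$. The graph $H$. In $\widetilde Q^1,\dots,\widetilde Q^4$ regard each $e^i_j$ as a half-edge (delete $y^i_j$), except $e^1_2,e^2_3,e^3_2,e^4_3$, which keep their degree-$1$ endvertices. $H$ is obtained from the disjoint union by gluing half-edges pairwise into single edges (gluing half-edges at $u$ and $v$ gives the edge $uv$): $e^1_1$ with $e^4_4$, $e^1_3$ with $e^4_5$; $e^4_1$ with $e^3_4$, $e^4_2$ with $e^3_5$; $e^3_1$ with $e^2_4$, $e^3_3$ with $e^2_5$; $e^2_1$ with $e^1_4$, $e^2_2$ with $e^1_5$; $e^1_6$ with $e^3_6$; $e^2_6$ with $e^4_6$; by identifying the degree-$1$ endvertices of $e^1_2$ and $e^3_2$ to one vertex $p$ and those of $e^2_3$ and $e^4_3$ to one vertex $q$; and by adding the edge $\alpha=pq$. Edge labels are kept, so an edge arising from two glued half-edges carries both labels. For each $i,j$, $A^i_j\subseteq H$ denotes the path in $H$ formed by all edges with the same labels as those of $A^i_j\subseteq\widetilde Q^i$ (including the full glued edges), and $A^i\subseteq H$ is the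 union of these three paths. $F:=A^1\cup A^2\cup A^3\cup A^4$ is a permutation $2$-factor of $H$ (consisting of two chordless circuits, not containing $\alpha$). -}

module Defs where

open import Data.Bool.Base using (Bool; true; false; T; _∧_; _∨_; not)
open import Data.Bool.ListAction using (any)
open import Data.Bool.Properties using (T-∧; T-∨; T-≡)
open import Data.Empty using (⊥-elim; ⊥-elim-irr)
open import Data.Fin.Base using (Fin; zero; suc)
import Data.Fin.Properties as Fin
open import Data.List.Base using (List; []; _∷_; _++_; map; concatMap; allFin; filterᵇ; length; lookup)
open import Data.List.Membership.Propositional using (_∈_; lose)
open import Data.List.Membership.Propositional.Properties using (∈-map⁺; ∈-map⁻; ∈-++⁺ˡ; ∈-++⁺ʳ; ∈-allFin; ∈-concatMap⁺; ∈-concatMap⁻; ∈-lookup)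
import Data.List.Membership.Setoid as SetoidMembership
open import Data.List.Relation.Unary.All as All using (All; []; _∷_; all?)
open import Data.List.Relation.Unary.AllPairs using ([]; _∷_)
open import Data.List.Relation.Unary.Any as Any using (Any; here; there)
open import Data.List.Relation.Unary.Any.Properties using (any⁺)
open import Data.List.Relation.Unary.Unique.Propositional using (Unique)
import Data.List.Relation.Unary.Unique.Propositional.Properties as Unique
import Data.List.Relation.Unary.Unique.Setoid as SetoidUnique
open import Data.Nat.Base using (ℕ; _≤_)
open import Data.Product.Base using (Σ; ∃; ∃₂; _×_; _,_; proj₁; proj₂)
import Data.Product.Properties as Product
open import Data.Refinement as Refinement using (Refinement-syntax; value)
open import Data.Irrelevant using ([_])
open import Data.Sum.Base as Sum using (_⊎_; inj₁; inj₂)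
import Data.Sum.Properties as Sum
open import Data.Unit.Base using (⊤; tt)
open import Function.Base using (_∘_)
open import Function.Bundles using (Equivalence)
open import Level using (0ℓ)
open import Relation.Binary.Bundles using (Setoid)
open import Relation.Binary.Construct.Closure.ReflexiveTransitive using (Star)
open import Relation.Binary.Definitions using (DecidableEquality)
open import Relation.Binary.PropositionalEquality using (_≡_; _≢_; _≗_; refl; sym; trans; cong)
open import Relation.Nullary using (¬_; Dec; yes; no; does; ¬?)
open import Relation.Nullary.Decidable using (toWitness; dec-true; _×-dec_; _⊎-dec_)
open import Relation.Unary using (Decidable)

record Finite (A : Set) : Set where
  field
    elements : List A
    complete : ∀ a → a ∈ elements
    unique   : Unique elements
    _≟_      : DecidableEquality A

  count : (A → Bool) → ℕ
  count p = length (filterᵇ p elements)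

Fin-finite : ∀ n → Finite (Fin n)
Fin-finite n = record
  { elements = allFin n
  ; complete = ∈-allFin
  ; unique   = Unique.allFin⁺ n
  ; _≟_      = Fin._≟_
  }

⊤-finite : Finite ⊤
⊤-finite = record
  { elements = tt ∷ []
  ; complete = λ _ → here refl
  ; unique   = [] ∷ []
  ; _≟_      = λ _ _ → yes refl
  }

⊎-finite : ∀ {A B} → Finite A → Finite B → Finite (A ⊎ B)
⊎-finite {A} {B} fA fB = record
  { elements = map inj₁ A.elements ++ map inj₂ B.elements
  ; complete = λ where
      (inj₁ a) → ∈-++⁺ˡ (∈-map⁺ inj₁ (A.complete a))
      (inj₂ b) → ∈-++⁺ʳ (map inj₁ A.elements) (∈-map⁺ inj₂ (B.complete b))
  ; unique   = Unique.++⁺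
      (Unique.map⁺ (λ { refl → refl }) A.unique)
      (Unique.map⁺ (λ { refl → refl }) B.unique)
      disjoint
  ; _≟_      = Sum.≡-dec A._≟_ B._≟_
  }
  where
  module A = Finite fA
  module B = Finite fB
  disjoint : ∀ {c : A ⊎ B} → ¬ (c ∈ map inj₁ A.elements × c ∈ map inj₂ B.elements)
  disjoint (p , q) with ∈-map⁻ inj₁ p | ∈-map⁻ inj₂ q
  ... | _ , _ , refl | _ , _ , ()

Σ-finite : ∀ {A : Set} {B : A → Set} → Finite A → (∀ a → Finite (B a)) → Finite (Σ A B)
Σ-finite {A} {B} fA fB = record
  { elements = concatMap fibre A.elements
  ; complete = λ { (a , b) → ∈-concatMap⁺ fibre (lose (A.complete a) (∈-map⁺ (a ,_) (B.complete a b))) }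
  ; unique   = unique-concat A.unique
  ; _≟_      = Product.≡-dec A._≟_ (B._≟_ _)
  }
  where
  module A = Finite fA
  module B a = Finite (fB a)
  fibre : (a : A) → List (Σ A B)
  fibre a = map (a ,_) (B.elements a)

  unique-concat : ∀ {as} → Unique as → Unique (concatMap fibre as)
  unique-concat [] = []
  unique-concat {a ∷ as} (a∉as ∷ u) =
    Unique.++⁺ (Unique.map⁺ (λ { refl → refl }) (B.unique a)) (unique-concat u) disjoint
    where
    first : ∀ {a c} → c ∈ fibre a → proj₁ c ≡ a
    first {a} p with ∈-map⁻ (a ,_) p
    ... | _ , _ , refl = refl
    disjoint : ∀ {c} → ¬ (c ∈ fibre a × c ∈ concatMap fibre as)
    disjoint {c} (p , q) =
      All.lookup a∉as (Any.map first (∈-concatMap⁻ fibre {xs = as} q)) (sym (first p))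

refinement-finite : ∀ {A : Set} {P : A → Set} → Decidable P → Finite A → Finite [ a ∈ A ∣ P a ]
refinement-finite {A} {P} P? fA = record
  { elements = refine A.elements
  ; complete = λ { (a Refinement., [ p ]) → refine-complete p (A.complete a) }
  ; unique   = refine-unique A.unique
  ; _≟_      = Refinement._≟_ A._≟_
  }
  where
  module A = Finite fA
  refine : List A → List [ a ∈ A ∣ P a ]
  refine [] = []
  refine (a ∷ as) with P? a
  ... | yes p = (a Refinement., [ p ]) ∷ refine as
  ... | no  _ = refine as

  refine-complete : ∀ {a as} .(p : P a) → a ∈ as → (a Refinement., [ p ]) ∈ refine as
  refine-complete {a} p (here refl) with P? a
  ... | yes _ = here refl
  ... | no ¬p = ⊥-elim-irr (¬p p)
  refine-complete {as = b ∷ _} p (there a∈) with P? b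
  ... | yes _ = there (refine-complete p a∈)
  ... | no  _ = refine-complete p a∈

  refine-∈ : ∀ {x as} → x ∈ refine as → value x ∈ as
  refine-∈ {as = a ∷ as} x∈ with P? a
  refine-∈ (here refl) | yes _ = here refl
  refine-∈ (there x∈)  | yes _ = there (refine-∈ x∈)
  refine-∈ x∈          | no  _ = there (refine-∈ x∈)

  refine-unique : ∀ {as} → Unique as → Unique (refine as)
  refine-unique [] = []
  refine-unique {a ∷ as} (a∉as ∷ u) with P? a
  ... | yes p = All.tabulate (λ x∈ eq → All.lookup a∉as (refine-∈ x∈) (cong value eq)) ∷ refine-unique u
  ... | no  _ = refine-unique u

-- Finite loopless graphs; parallel edges are not excluded here (they form
-- circuits of length 2, so girth ≥ 3 means simple).  The order of the two
-- ends of an edge carries no information.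

record Graph : Set₁ where
  field
    V E      : Set
    V-finite : Finite V
    E-finite : Finite E
    ends     : E → V × V
    loopless : ∀ e → proj₁ (ends e) ≢ proj₂ (ends e)

  module FV = Finite V-finite
  module FE = Finite E-finite

  Incident : V → E → Set
  Incident v e = v ≡ proj₁ (ends e) ⊎ v ≡ proj₂ (ends e)

  incident? : ∀ v e → Dec (Incident v e)
  incident? v e = (v FV.≟ proj₁ (ends e)) ⊎-dec (v FV.≟ proj₂ (ends e))

  Joins : E → V → V → Set
  Joins e u v = ends e ≡ (u , v) ⊎ ends e ≡ (v , u)

record Subgraph (G : Graph) : Set where
  open Graph G
  field
    vs     : V → Bool
    es     : E → Bool
    closed : ∀ {v e} → T (es e) → Incident v e → T (vs v)

  hasV : V → Set
  hasV v = T (vs v)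

  hasE : E → Set
  hasE e = T (es e)

  ∣V∣ ∣E∣ : ℕ
  ∣V∣ = FV.count vs
  ∣E∣ = FE.count es

  degree : V → ℕ
  degree v = FE.count (λ e → es e ∧ does (incident? v e))

  Adjacent : V → V → Set
  Adjacent u v = ∃ λ e → hasE e × Joins e u v

open Subgraph public using (hasV; hasE)

module _ {G : Graph} where
  open Graph G
  open Subgraph

  infix 4 _≈_ _⊆_
  infixl 6 _∪_

  _≈_ : Subgraph G → Subgraph G → Set
  K ≈ L = vs K ≗ vs L × es K ≗ es L

  _⊆_ : Subgraph G → Subgraph G → Set
  K ⊆ L = (∀ v → hasV K v → hasV L v) × (∀ e → hasE K e → hasE L e)

  _∪_ : Subgraph G → Subgraph G → Subgraph G
  K ∪ L = record
    { vs     = λ v → vs K v ∨ vs L v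
    ; es     = λ e → es K e ∨ es L e
    ; closed = λ {_} {e} e∈ i → Equivalence.from T-∨
        (Sum.map (λ p → closed K p i) (λ p → closed L p i) (Equivalence.to (T-∨ {es K e}) e∈))
    }

  deleteVertex : Subgraph G → V → Subgraph G
  deleteVertex K v = record
    { vs     = λ u → vs K u ∧ not (does (u FV.≟ v))
    ; es     = λ e → es K e ∧ not (does (incident? v e))
    ; closed = cl
    }
    where
    cl : ∀ {u e} → T (es K e ∧ not (does (incident? v e))) → Incident u e →
         T (vs K u ∧ not (does (u FV.≟ v)))
    cl {u} {e} e∈ i with Equivalence.to (T-∧ {es K e}) e∈
    ... | p , q with u FV.≟ v
    ... | no _ = Equivalence.from T-∧ (closed K p i , tt)
    ... | yes refl = ⊥-elim (excluded (incident? v e) i q)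
      where
      excluded : ∀ {P : Set} (d : Dec P) → P → ¬ T (not (does d))
      excluded (yes _) _ ()
      excluded (no ¬p) p _ = ¬p p

  Regular : ℕ → Subgraph G → Set
  Regular d K = ∀ v → hasV K v → degree K v ≡ d

  Connected : Subgraph G → Set
  Connected K = ∃ (hasV K) × (∀ u v → hasV K u → hasV K v → Star (Adjacent K) u v)

  -- With parallel edges allowed, a loopless graph is 2-connected if it is
  -- connected, has no cut vertex and is neither K₁ nor K₂; the last
  -- condition is expressed by the presence of at least two edges.

  TwoConnected : Subgraph G → Set
  TwoConnected K = 2 ≤ ∣E∣ K × Connected K × (∀ v → hasV K v → Connected (deleteVertex K v))

  IsCircuit : Subgraph G → Set
  IsCircuit K = Regular 2 K × TwoConnected K

  IsComponent : Subgraph G → Subgraph G → Set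
  IsComponent C K = C ⊆ K × Connected C × (∀ D → C ⊆ D → D ⊆ K → Connected D → D ⊆ C)

  Chordless : Subgraph G → Set
  Chordless C = ∀ e → (∀ v → Incident v e → hasV C v) → hasE C e

  IsTwoFactor : Subgraph G → Set
  IsTwoFactor K = (∀ v → hasV K v) × Regular 2 K

module _ (G : Graph) where
  open Graph G
  open Subgraph

  whole : Subgraph G
  whole = record { vs = λ _ → true ; es = λ _ → true ; closed = λ _ _ → tt }

  deleteEdges : (E → Bool) → Subgraph G
  deleteEdges M = record { vs = λ _ → true ; es = λ e → not (M e) ; closed = λ _ _ → tt }

  edgeInduced : (E → Bool) → Subgraph G
  edgeInduced M = record
    { vs     = λ v → any (λ e → M e ∧ does (incident? v e)) FE.elements
    ; es     = M
    ; closed = λ {v} {e} e∈M i → any⁺ _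
        (lose (FE.complete e) (Equivalence.from T-∧ (e∈M , Equivalence.from T-≡ (dec-true (incident? v e) i))))
    }

  subgraphSetoid : Setoid 0ℓ 0ℓ
  subgraphSetoid = record
    { Carrier = Subgraph G
    ; _≈_     = _≈_
    ; isEquivalence = record
      { refl  = (λ _ → refl) , (λ _ → refl)
      ; sym   = λ (p , q) → (λ v → sym (p v)) , (λ e → sym (q e))
      ; trans = λ (p , q) (p′ , q′) → (λ v → trans (p v) (p′ v)) , (λ e → trans (q e) (q′ e))
      }
    }

  Cubic : Set
  Cubic = Regular 3 whole

module _ {G : Graph} where
  open Graph G
  open Subgraph
  open SetoidMembership (subgraphSetoid G) public using () renaming (_∈_ to _∈ˢ_)

  -- A set of subgraphs is a list without repetitions, up to _≈_.  The null
  -- subgraph may be an element, having no components.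

  record IsCDC (S : List (Subgraph G)) : Set where
    field
      distinct : SetoidUnique.Unique (subgraphSetoid G) S
      circuits : ∀ {K} → K ∈ˢ S → ∀ C → IsComponent C K → IsCircuit C
      double   : ∀ e → length (filterᵇ (λ K → es K e) S) ≡ 2

module _ (G : Graph) where
  open Graph G
  open Subgraph

  IsCyclicCut : (E → Bool) → Set
  IsCyclicCut M = ∃₂ λ (C D : Subgraph G) →
    IsComponent C (deleteEdges G M) × IsComponent D (deleteEdges G M) × ¬ (C ≈ D) ×
    (∃ λ K → K ⊆ C × IsCircuit K) × (∃ λ K → K ⊆ D × IsCircuit K)

  -- λ_c(G) ≥ k, with the convention that λ_c(G) = ∞ if G has no cyclic cut.

  CyclicallyEdgeConnected : ℕ → Set
  CyclicallyEdgeConnected k = ∀ M → IsCyclicCut M → k ≤ FE.count M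

  GirthAtLeast : ℕ → Set
  GirthAtLeast g = ∀ (C : Subgraph G) → IsCircuit C → g ≤ ∣E∣ C

  ThreeEdgeColorable : Set
  ThreeEdgeColorable = ∃ λ (c : E → Fin 3) →
    ∀ v e f → Incident v e → Incident v f → e ≢ f → c e ≢ c f

  IsSnark : Set
  IsSnark = Cubic G × CyclicallyEdgeConnected 4 × GirthAtLeast 5 × ¬ ThreeEdgeColorable

  record PermutationTwoFactor : Set where
    field
      C₁ C₂      : Subgraph G
      circuit₁   : IsCircuit C₁
      circuit₂   : IsCircuit C₂
      chordless₁ : Chordless C₁
      chordless₂ : Chordless C₂
      disjoint   : ∀ v → hasV C₁ v → ¬ hasV C₂ v
      twoFactor  : IsTwoFactor (C₁ ∪ C₂)

    F : Subgraph G
    F = C₁ ∪ C₂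

  IsCyclePermutationGraph : Set
  IsCyclePermutationGraph = Cubic G × PermutationTwoFactor

  IsPermutationSnark : Set
  IsPermutationSnark = IsCyclePermutationGraph × IsSnark

record Labelling {Q : Graph} (P : PermutationTwoFactor Q) : Set where
  open Graph Q
  open PermutationTwoFactor P
  open Subgraph using (Adjacent)
  field
    x₁ x₂ x₄ x₅ x₆ z₁ z₂ : V
    x₁x₂       : E
    distinct₁  : Unique (x₁ ∷ x₂ ∷ z₂ ∷ x₆ ∷ [])
    x₁x₂-joins : Joins x₁x₂ x₁ x₂
    x₁x₂∈C₁    : hasE C₁ x₁x₂
    x₂z₂∈C₁    : Adjacent C₁ x₂ z₂
    z₂x₆∈C₁    : Adjacent C₁ z₂ x₆
    distinct₂  : Unique (x₄ ∷ z₁ ∷ x₅ ∷ [])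
    x₄z₁∈C₂    : Adjacent C₂ x₄ z₁
    z₁x₅∈C₂    : Adjacent C₂ z₁ x₅
    z₁z₂       : Adjacent (whole Q) z₁ z₂

record Piece : Set₁ where
  field
    Q         : Graph
    factor    : PermutationTwoFactor Q
    labelling : Labelling factor

  open Graph Q public
  open PermutationTwoFactor factor public
  open Labelling labelling public

data HalfEdge : Set where
  e₁ e₂ e₃ e₄ e₅ e₆ : HalfEdge

-- Q̃ is split into its core, Q - x₁x₂ - z₁ - z₂, and the six half-edges eⱼ,
-- of which `attach` gives the endvertex in the core.

module _ (P : Piece) where
  open Piece P

  IsCoreVertex : V → Set
  IsCoreVertex v = v ≢ z₁ × v ≢ z₂

  IsCoreEdge : E → Set
  IsCoreEdge e = e ≢ x₁x₂ × ¬ Incident z₁ e × ¬ Incident z₂ e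

  CoreV : Set
  CoreV = [ v ∈ V ∣ IsCoreVertex v ]

  CoreE : Set
  CoreE = [ e ∈ E ∣ IsCoreEdge e ]

  CoreV-finite : Finite CoreV
  CoreV-finite = refinement-finite (λ v → ¬? (v FV.≟ z₁) ×-dec ¬? (v FV.≟ z₂)) V-finite

  CoreE-finite : Finite CoreE
  CoreE-finite = refinement-finite
    (λ e → ¬? (e FE.≟ x₁x₂) ×-dec ¬? (incident? z₁ e) ×-dec ¬? (incident? z₂ e)) E-finite

  coreEnds : CoreE → CoreV × CoreV
  coreEnds (e Refinement., [ p ]) =
      (proj₁ (ends e) Refinement., [ (λ eq → proj₁ (proj₂ p) (inj₁ (sym eq))) , (λ eq → proj₂ (proj₂ p) (inj₁ (sym eq))) ])
    , (proj₂ (ends e) Refinement., [ (λ eq → proj₁ (proj₂ p) (inj₂ (sym eq))) , (λ eq → proj₂ (proj₂ p) (inj₂ (sym eq))) ])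

  private
    joins-left : ∀ {u v} (K : Subgraph Q) → Subgraph.Adjacent K u v → hasV K u
    joins-left K (e , e∈ , inj₁ eq) = Subgraph.closed K e∈ (inj₁ (sym (cong proj₁ eq)))
    joins-left K (e , e∈ , inj₂ eq) = Subgraph.closed K e∈ (inj₂ (sym (cong proj₂ eq)))

    joins-right : ∀ {u v} (K : Subgraph Q) → Subgraph.Adjacent K u v → hasV K v
    joins-right K (e , e∈ , j) = joins-left K (e , e∈ , Sum.swap j)

    on-C₁ : ∀ {v} → hasV C₁ v → v ≢ z₂ → CoreV
    on-C₁ {v} v∈ v≢z₂ =
      v Refinement., [ (λ { refl → disjoint v v∈ (joins-left C₂ z₁x₅∈C₂) }) , v≢z₂ ]

    on-C₂ : ∀ {v} → hasV C₂ v → v ≢ z₁ → CoreV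
    on-C₂ {v} v∈ v≢z₁ =
      v Refinement., [ v≢z₁ , (λ { refl → disjoint v (joins-left C₁ z₂x₆∈C₁) v∈ }) ]

    x₁≢z₂ : x₁ ≢ z₂
    x₁≢z₂ with (_ ∷ p ∷ _) ∷ _ ← distinct₁ = p
    x₂≢z₂ : x₂ ≢ z₂
    x₂≢z₂ with _ ∷ (p ∷ _) ∷ _ ← distinct₁ = p
    x₆≢z₂ : x₆ ≢ z₂
    x₆≢z₂ with _ ∷ _ ∷ (p ∷ _) ∷ _ ← distinct₁ = p ∘ sym
    x₄≢z₁ : x₄ ≢ z₁
    x₄≢z₁ with (p ∷ _) ∷ _ ← distinct₂ = p
    x₅≢z₁ : x₅ ≢ z₁
    x₅≢z₁ with _ ∷ (p ∷ _) ∷ _ ← distinct₂ = p ∘ sym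

  attach : HalfEdge → CoreV
  attach e₁ = on-C₁ {x₁} (joins-left C₁ (x₁x₂ , x₁x₂∈C₁ , x₁x₂-joins)) x₁≢z₂
  attach e₂ = on-C₁ {x₂} (joins-left C₁ x₂z₂∈C₁) x₂≢z₂
  attach e₃ = on-C₁ {x₂} (joins-left C₁ x₂z₂∈C₁) x₂≢z₂
  attach e₄ = on-C₂ {x₄} (joins-left C₂ x₄z₁∈C₂) x₄≢z₁
  attach e₅ = on-C₂ {x₅} (joins-right C₂ z₁x₅∈C₂) x₅≢z₁
  attach e₆ = on-C₁ {x₆} (joins-right C₁ z₂x₆∈C₁) x₆≢z₂

-- #1, …, #4 index the pieces Q¹, …, Q⁴.

pattern #1 = zero
pattern #2 = suc zero
pattern #3 = suc (suc zero)
pattern #4 = suc (suc (suc zero))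

pattern pole-p = zero
pattern pole-q = suc zero

gluings : List ((Fin 4 × HalfEdge) × (Fin 4 × HalfEdge))
gluings =
    ((#1 , e₁) , (#4 , e₄)) ∷ ((#1 , e₃) , (#4 , e₅))
  ∷ ((#4 , e₁) , (#3 , e₄)) ∷ ((#4 , e₂) , (#3 , e₅))
  ∷ ((#3 , e₁) , (#2 , e₄)) ∷ ((#3 , e₃) , (#2 , e₅))
  ∷ ((#2 , e₁) , (#1 , e₄)) ∷ ((#2 , e₂) , (#1 , e₅))
  ∷ ((#1 , e₆) , (#3 , e₆))
  ∷ ((#2 , e₆) , (#4 , e₆))
  ∷ []

pendants : List ((Fin 4 × HalfEdge) × Fin 2)
pendants =
    ((#1 , e₂) , pole-p) ∷ ((#3 , e₂) , pole-p)
  ∷ ((#2 , e₃) , pole-q) ∷ ((#4 , e₃) , pole-q)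
  ∷ []

gluings-distinct : All (λ ((i , _) , (k , _)) → i ≢ k) gluings
gluings-distinct = toWitness {a? = all? (λ ((i , _) , (k , _)) → ¬? (i Fin.≟ k)) gluings} tt

module _ (Q : Fin 4 → Piece) where

  VH : Set
  VH = (Σ (Fin 4) λ i → CoreV (Q i)) ⊎ Fin 2

  EH : Set
  EH = (Σ (Fin 4) λ i → CoreE (Q i)) ⊎ Fin (length gluings) ⊎ Fin (length pendants) ⊎ ⊤

pattern coreV i v   = inj₁ (i , v)
pattern poleV k     = inj₂ k
pattern coreE i e   = inj₁ (i , e)
pattern glued g     = inj₂ (inj₁ g)
pattern pendant g   = inj₂ (inj₂ (inj₁ g))
pattern α           = inj₂ (inj₂ (inj₂ tt))

module _ (Q : Fin 4 → Piece) where

  half : Fin 4 × HalfEdge → VH Q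
  half (i , j) = coreV i (attach (Q i) j)

  endsH : EH Q → VH Q × VH Q
  endsH (coreE i e) = coreV i (proj₁ (coreEnds (Q i) e)) , coreV i (proj₂ (coreEnds (Q i) e))
  endsH (glued g)   = half (proj₁ (lookup gluings g)) , half (proj₂ (lookup gluings g))
  endsH (pendant g) = half (proj₁ (lookup pendants g)) , poleV (proj₂ (lookup pendants g))
  endsH α           = poleV pole-p , poleV pole-q

  private
    looplessH : ∀ e → proj₁ (endsH e) ≢ proj₂ (endsH e)
    looplessH (coreE i e) eq = Piece.loopless (Q i) (value e) (value-eq eq)
      where
      value-eq : ∀ {u v : CoreV (Q i)} → _≡_ {A = VH Q} (coreV i u) (coreV i v) → value u ≡ value v
      value-eq refl = refl
    looplessH (glued g) eq = All.lookup gluings-distinct (∈-lookup g) (piece-eq eq)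
      where
      piece-eq : ∀ {i k u v} → _≡_ {A = VH Q} (coreV i u) (coreV k v) → i ≡ k
      piece-eq refl = refl
    looplessH (pendant g) ()
    looplessH α ()

  H : Graph
  H = record
    { V        = VH Q
    ; E        = EH Q
    ; V-finite = ⊎-finite (Σ-finite (Fin-finite 4) (λ i → CoreV-finite (Q i))) (Fin-finite 2)
    ; E-finite = ⊎-finite (Σ-finite (Fin-finite 4) (λ i → CoreE-finite (Q i)))
                   (⊎-finite (Fin-finite _) (⊎-finite (Fin-finite _) ⊤-finite))
    ; ends     = endsH
    ; loopless = looplessH
    }

  -- All six half-edges of the i-th piece belong to Aⁱ = Aⁱ₁ ∪ Aⁱ₂ ∪ Aⁱ₃, whose
  -- other edges are the core edges of Fⁱ; a glued edge lies in both of the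
  -- Aⁱ of which it carries a label.

  inA : Fin 4 → EH Q → Bool
  inA i (coreE k e) = does (i Fin.≟ k) ∧ Subgraph.es (Piece.F (Q k)) (value e)
  inA i (glued g)   = does (i Fin.≟ proj₁ (proj₁ (lookup gluings g)))
                    ∨ does (i Fin.≟ proj₁ (proj₂ (lookup gluings g)))
  inA i (pendant g) = does (i Fin.≟ proj₁ (proj₁ (lookup pendants g)))
  inA i α           = false

  A : Fin 4 → Subgraph H
  A i = edgeInduced H (inA i)

  FH : Subgraph H
  FH = A #1 ∪ A #2 ∪ A #3 ∪ A #4

{-# OPTIONS --safe #-}
module Submission where

-- In S ∖ {F} every edge of F lies in exactly one member, its colour; every
-- member contains an even number of the six half-edges of a piece, and the
-- half-edges e₂, e₃ at x₂ never have the same colour.  If, in some piece, e₁ has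
-- the colour of one of e₂, e₃ and the other one does not have that of e₆, then
-- the members extend over the deleted edges of Q to a CDC of Q containing its
-- 2-factor: the colours of e₁, of the other one and of e₆ pass to x₁x₂, x₂z₂ and
-- z₂x₆, those of e₄ and e₅ to x₄z₁ and z₁x₅, and z₁z₂ gets the colours at z₂.
-- Hence no piece is of this kind.  Going around the four pieces, this forces the
-- two edges of F at p to have the same colour; by parity no member would then
-- contain α, which lies in two of them.
--
-- In a cubic graph a set of edges is a union of disjoint circuits as soon as it
-- has even parity at each vertex, so circuits are handled by parities in 𝔽₂.

open import Defs
open import Data.Bool.Base using (Bool; true; false; T; _∧_; _∨_; _xor_; not; if_then_else_)
open import Data.Bool.ListAction using (any)
open import Data.Bool.Properties as Bool using (T-≡; T-∨; xor-assoc; xor-comm; xor-identityʳ; ∧-comm; ∧-zeroʳ)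
open import Data.Bool.Solver using (module xor-∧-Solver)
open import Data.Empty using (⊥; ⊥-elim; ⊥-elim-irr)
open import Data.Fin using (Fin; zero; suc; #_)
import Data.Fin.Properties as Fin
open import Data.Irrelevant using ([_])
open import Data.List.Base using (List; []; _∷_; _++_; map; filterᵇ; length; concatMap; allFin; lookup)
open import Data.List.Membership.Propositional using (_∈_; find; lose)
open import Data.List.Membership.Propositional.Properties using (∈-map⁺; ∈-lookup)
open import Data.List.Properties using (map-tabulate; tabulate-lookup)
open import Data.List.Relation.Unary.All as All using (All; []; _∷_)
import Data.List.Relation.Unary.All.Properties as All
open import Data.List.Relation.Unary.AllPairs using ([]; _∷_)
open import Data.List.Relation.Unary.Any as Any using (here; there; any?)
import Data.List.Relation.Unary.Any.Properties as Any
open import Data.List.Relation.Unary.Unique.Propositional using (Unique)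
import Data.List.Relation.Unary.Unique.Setoid as SetoidUnique
open import Data.Nat.Base using (ℕ; zero; suc; _+_; _≤_; z≤n; s≤s)
import Data.Nat.Properties as ℕ
open import Data.Product.Base using (Σ; ∃; _×_; _,_; proj₁; proj₂)
import Data.Product.Properties as Product
open import Data.Refinement as Refinement using (Refinement-syntax; value; value-injective)
open import Data.Sum.Base as Sum using (_⊎_; inj₁; inj₂)
open import Data.Unit.Base using (⊤; tt)
open import Function.Base using (_∘_; id)
open import Function.Bundles using (Equivalence; mk⇔)
open import Relation.Binary.Construct.Closure.ReflexiveTransitive as Star using (Star; ε; _◅_; _◅◅_)
open import Relation.Binary.Definitions using () renaming (Decidable to Decidable₂)
open import Relation.Binary.PropositionalEquality
open import Relation.Nullary using (¬_; Dec; yes; no; does; ¬?)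
open import Relation.Nullary.Decidable using (dec-true; dec-false; _⊎-dec_; does-⇔; T?; _×-dec_; map′; decidable-stable)
open import Relation.Unary using (Decidable)

-- Parity and counting

-- The step round the four pieces. `e₄` and `e₅` of a piece are glued to `e₁` and to one of `e₂`,
-- `e₃` of the next piece; the other of these two ends at a pole, p for Q¹ and Q³, q for Q² and Q⁴.
-- Suppose `e₁` has the colour of one of `e₂`, `e₃` in some piece. As the piece does not extend, the
-- other one has the colour of `e₆`. These four half-edges cancel in every member, so `e₄` and `e₅`
-- agree, and the next piece is in the same situation. It thus holds all the way round, and the edge
-- at the pole has the colour of `e₆` in every piece. Since the `e₆` of Q¹ and Q³ are one edge, the
-- two colours at p are equal. Otherwise `e₁` differs from `e₂` and `e₃` in every piece. If the
-- colours at p are distinct, they are the two members through α, and so are the colours at q. Each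
-- colour at p is then also one at q, and either way of matching them gives two opposite pieces in
-- which parity leaves only `e₆` to repeat the colour at the pole. So the colours at p agree once
-- more.

≡true : ∀ {b} → T b → b ≡ true
≡true = Equivalence.to T-≡

true≡ : ∀ {b} → b ≡ true → T b
true≡ = Equivalence.from T-≡

does-sound : ∀ {P : Set} (d : Dec P) → does d ≡ true → P
does-sound (yes p) _ = p

≢true⇒≡false : ∀ {b} → ¬ (b ≡ true) → b ≡ false
≢true⇒≡false = Bool.¬-not

true≢false : ∀ {b} → b ≡ true → b ≡ false → ⊥
true≢false refl ()

∧-true : ∀ {a b} → a ∧ b ≡ true → a ≡ true × b ≡ true
∧-true {true} eq = refl , eq

∧-intro : ∀ {a b} → a ≡ true → b ≡ true → a ∧ b ≡ true
∧-intro refl refl = refl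

card : ∀ {A : Set} → (A → Bool) → List A → ℕ
card p xs = length (filterᵇ p xs)

parity : ∀ {A : Set} → (A → Bool) → List A → Bool
parity f []       = false
parity f (x ∷ xs) = f x xor parity f xs

odd : ℕ → Bool
odd zero    = false
odd (suc n) = not (odd n)

module _ {A : Set} where

  card-cong : ∀ {p q : A → Bool} → (∀ x → p x ≡ q x) → ∀ xs → card p xs ≡ card q xs
  card-cong p≗q [] = refl
  card-cong {p} {q} p≗q (x ∷ xs) with p x | q x | p≗q x
  ... | true  | _ | refl = cong suc (card-cong p≗q xs)
  ... | false | _ | refl = card-cong p≗q xs

  card-∨-∧ : ∀ (p q : A → Bool) xs →
    card (λ x → p x ∨ q x) xs + card (λ x → p x ∧ q x) xs ≡ card p xs + card q xs
  card-∨-∧ p q [] = refl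
  card-∨-∧ p q (x ∷ xs) with p x | q x
  ... | true  | true  = cong suc (trans (ℕ.+-suc _ _) (trans (cong suc (card-∨-∧ p q xs)) (sym (ℕ.+-suc _ _))))
  ... | true  | false = cong suc (card-∨-∧ p q xs)
  ... | false | true  = trans (cong suc (card-∨-∧ p q xs)) (sym (ℕ.+-suc _ _))
  ... | false | false = card-∨-∧ p q xs

  card-mono : ∀ {p q : A → Bool} → (∀ x → p x ≡ true → q x ≡ true) → ∀ xs → card p xs ≤ card q xs
  card-mono p⇒q [] = z≤n
  card-mono {p} {q} p⇒q (x ∷ xs) with p x | q x | p⇒q x
  ... | true  | true  | _ = s≤s (card-mono p⇒q xs)
  ... | true  | false | i with () ← i refl
  ... | false | true  | _ = ℕ.m≤n⇒m≤1+n (card-mono p⇒q xs)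
  ... | false | false | _ = card-mono p⇒q xs

  card-none : ∀ {p : A → Bool} → (∀ x → p x ≡ false) → ∀ xs → card p xs ≡ 0
  card-none none [] = refl
  card-none {p} none (x ∷ xs) with p x | none x
  ... | false | _ = card-none none xs

  card-witness : ∀ (p : A → Bool) xs → 1 ≤ card p xs → ∃ λ x → p x ≡ true
  card-witness p (x ∷ xs) 1≤ with p x in eq
  ... | true  = x , eq
  ... | false = card-witness p xs 1≤

  card-positive : ∀ {p : A → Bool} {x xs} → x ∈ xs → p x ≡ true → 1 ≤ card p xs
  card-positive {p} {x} (here refl) px with p x
  card-positive (here refl) refl | true = s≤s z≤n
  card-positive {p} {x} {y ∷ _} (there x∈) px with p y
  ... | true  = s≤s z≤n
  ... | false = card-positive x∈ px

  parity-cong : ∀ {f g : A → Bool} → (∀ x → f x ≡ g x) → ∀ xs → parity f xs ≡ parity g xs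
  parity-cong f≗g []       = refl
  parity-cong f≗g (x ∷ xs) = cong₂ _xor_ (f≗g x) (parity-cong f≗g xs)

  parity-none : ∀ {f : A → Bool} → (∀ x → f x ≡ false) → ∀ xs → parity f xs ≡ false
  parity-none none []       = refl
  parity-none none (x ∷ xs) = cong₂ _xor_ (none x) (parity-none none xs)

  parity-xor : ∀ (f g : A → Bool) xs → parity (λ x → f x xor g x) xs ≡ parity f xs xor parity g xs
  parity-xor f g []       = refl
  parity-xor f g (x ∷ xs) = trans (cong ((f x xor g x) xor_) (parity-xor f g xs))
    (solve 4 (λ a b c d → (a :+ b) :+ (c :+ d) := (a :+ c) :+ (b :+ d)) refl (f x) (g x) (parity f xs) (parity g xs))
    where open xor-∧-Solver

  parity-∧ˡ : ∀ c (f : A → Bool) xs → parity (λ x → c ∧ f x) xs ≡ c ∧ parity f xs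
  parity-∧ˡ true  f xs = refl
  parity-∧ˡ false f xs = parity-none (λ _ → refl) xs

  parity-∧ʳ : ∀ c (f : A → Bool) xs → parity (λ x → f x ∧ c) xs ≡ parity f xs ∧ c
  parity-∧ʳ c f xs = trans (parity-cong (λ x → ∧-comm (f x) c) xs) (trans (parity-∧ˡ c f xs) (∧-comm c _))

  parity-++ : ∀ (f : A → Bool) xs ys → parity f (xs ++ ys) ≡ parity f xs xor parity f ys
  parity-++ f []       ys = refl
  parity-++ f (x ∷ xs) ys = trans (cong (f x xor_) (parity-++ f xs ys)) (sym (xor-assoc (f x) _ _))

  parity≡odd : ∀ (f : A → Bool) xs → parity f xs ≡ odd (card f xs)
  parity≡odd f [] = refl
  parity≡odd f (x ∷ xs) with f x
  ... | true  = cong not (parity≡odd f xs)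
  ... | false = parity≡odd f xs

parity-map : ∀ {A B : Set} (f : B → Bool) (h : A → B) xs → parity f (map h xs) ≡ parity (f ∘ h) xs
parity-map f h []       = refl
parity-map f h (x ∷ xs) = cong (f (h x) xor_) (parity-map f h xs)

parity-swap : ∀ {A B : Set} (f : A → B → Bool) xs ys →
  parity (λ x → parity (f x) ys) xs ≡ parity (λ y → parity (λ x → f x y) xs) ys
parity-swap f []       ys = sym (parity-none (λ _ → refl) ys)
parity-swap f (x ∷ xs) ys = trans (cong (parity (f x) ys xor_) (parity-swap f xs ys)) (sym (parity-xor (f x) _ ys))

module _ {A : Set} (fA : Finite A) where
  open Finite fA

  private
    card-absent : ∀ a {xs} → All (a ≢_) xs → card (λ x → does (x ≟ a)) xs ≡ 0
    card-absent a [] = refl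
    card-absent a {x ∷ _} (a≢x ∷ a∉) with x ≟ a
    ... | yes refl = ⊥-elim (a≢x refl)
    ... | no _     = card-absent a a∉

    card-present : ∀ {a xs} → Unique xs → a ∈ xs → card (λ x → does (x ≟ a)) xs ≡ 1
    card-present {a} (a∉ ∷ _) (here refl) with a ≟ a
    ... | yes _  = cong suc (card-absent a a∉)
    ... | no a≢a = ⊥-elim (a≢a refl)
    card-present {a} {x ∷ _} (x∉ ∷ u) (there a∈) with x ≟ a
    ... | yes refl = ⊥-elim (All.lookup x∉ a∈ refl)
    ... | no _     = card-present u a∈

  card-singleton : ∀ a → card (λ x → does (x ≟ a)) elements ≡ 1
  card-singleton a = card-present unique (complete a)

  does-refl : ∀ a → does (a ≟ a) ≡ true
  does-refl a = dec-true (a ≟ a) refl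

  does-sym : ∀ a b → does (a ≟ b) ≡ does (b ≟ a)
  does-sym a b = does-⇔ (mk⇔ sym sym) (a ≟ b) (b ≟ a)

  parity-singleton : ∀ a → parity (λ x → does (x ≟ a)) elements ≡ true
  parity-singleton a = trans (parity≡odd _ elements) (cong odd (card-singleton a))

  -- Summation against a Kronecker delta. After an exchange of sums by `parity-swap`, this is what
  -- collapses the inner one.
  parity-pick : ∀ a (g : A → Bool) → parity (λ x → does (x ≟ a) ∧ g x) elements ≡ g a
  parity-pick a g = trans (parity-cong at-a elements)
    (trans (parity-∧ʳ (g a) _ elements) (cong (_∧ g a) (parity-singleton a)))
    where
    at-a : ∀ x → does (x ≟ a) ∧ g x ≡ does (x ≟ a) ∧ g a
    at-a x with x ≟ a
    ... | yes refl = refl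
    ... | no _     = refl

  -- Striking off one known element at a time is how the lemmas up to `card-third` turn a known
  -- count into information on the elements counted.
  card-remove : ∀ {p : A → Bool} a → p a ≡ true →
    card p elements ≡ suc (card (λ x → p x ∧ not (does (x ≟ a))) elements)
  card-remove {p} a pa = begin
    card p elements                                           ≡⟨ card-cong union elements ⟨
    card (λ x → is x ∨ rest x) elements                       ≡⟨ ℕ.+-identityʳ _ ⟨
    card (λ x → is x ∨ rest x) elements + 0                   ≡⟨ cong (card (λ x → is x ∨ rest x) elements +_) (card-none disjoint elements) ⟨
    card (λ x → is x ∨ rest x) elements + card (λ x → is x ∧ rest x) elements ≡⟨ card-∨-∧ is rest elements ⟩
    card is elements + card rest elements                     ≡⟨ cong (_+ card rest elements) (card-singleton a) ⟩
    suc (card rest elements)                                  ∎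
    where
    open ≡-Reasoning
    is rest : A → Bool
    is x = does (x ≟ a)
    rest x = p x ∧ not (is x)
    union : ∀ x → is x ∨ rest x ≡ p x
    union x with x ≟ a
    ... | yes refl = sym pa
    ... | no _     = Bool.∧-identityʳ (p x)
    disjoint : ∀ x → is x ∧ rest x ≡ false
    disjoint x with x ≟ a
    ... | yes _ = ∧-zeroʳ (p x)
    ... | no _  = refl

  card-zero : ∀ {p : A → Bool} → card p elements ≡ 0 → ∀ x → p x ≡ false
  card-zero {p} eq x with p x in px
  ... | false = refl
  ... | true with () ← subst (1 ≤_) eq (card-positive {p = p} (complete x) px)

  keep : ∀ {p : A → Bool} {a b} → p a ≡ true → a ≢ b → p a ∧ not (does (a ≟ b)) ≡ true
  keep {a = a} {b} pa a≢b = ∧-intro pa (cong not (dec-false (a ≟ b) a≢b))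

  kept : ∀ {p : A → Bool} {a b} → p a ∧ not (does (a ≟ b)) ≡ true → p a ≡ true × a ≢ b
  kept {p} {a} {b} eq with ∧-true {p a} eq
  ... | pa , q = pa , λ a≡b → true≢false q (cong not (dec-true (a ≟ b) a≡b))

  card-one : ∀ {p : A → Bool} {a} → card p elements ≡ 1 → p a ≡ true → ∀ x → p x ≡ true → x ≡ a
  card-one {p} {a} one pa x px with x ≟ a
  ... | yes eq = eq
  ... | no x≢a = ⊥-elim (true≢false (keep {p} px x≢a)
          (card-zero (ℕ.suc-injective (trans (sym (card-remove a pa)) one)) x))

  card-two : ∀ {p : A → Bool} {a b} → card p elements ≡ 2 → p a ≡ true → p b ≡ true → b ≢ a →
    ∀ x → p x ≡ true → x ≡ a ⊎ x ≡ b
  card-two {p} {a} {b} two pa pb b≢a x px with x ≟ a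
  ... | yes eq = inj₁ eq
  ... | no x≢a = inj₂ (card-one (ℕ.suc-injective (trans (sym (card-remove a pa)) two))
          (keep {p} pb b≢a) x (keep {p} px x≢a))

  card-three : ∀ {p : A → Bool} {a b c} → card p elements ≡ 3 →
    p a ≡ true → p b ≡ true → p c ≡ true → b ≢ a → c ≢ a → c ≢ b →
    ∀ x → p x ≡ true → x ≡ a ⊎ x ≡ b ⊎ x ≡ c
  card-three {p} {a} three pa pb pc b≢a c≢a c≢b x px with x ≟ a
  ... | yes eq = inj₁ eq
  ... | no x≢a = inj₂ (card-two (ℕ.suc-injective (trans (sym (card-remove a pa)) three))
          (keep {p} pb b≢a) (keep {p} pc c≢a) c≢b x (keep {p} px x≢a))

  card-third : ∀ {p : A → Bool} {a b} → card p elements ≡ 3 → p a ≡ true → p b ≡ true → b ≢ a →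
    ∃ λ c → p c ≡ true × c ≢ a × c ≢ b
  card-third {p} {a} {b} three pa pb b≢a
    with card-witness rest elements (subst (1 ≤_) (ℕ.suc-injective (ℕ.suc-injective (trans (sym three) eq))) (s≤s z≤n))
    where
    p′ rest : A → Bool
    p′ x = p x ∧ not (does (x ≟ a))
    rest x = p′ x ∧ not (does (x ≟ b))
    eq : card p elements ≡ suc (suc (card rest elements))
    eq = trans (card-remove a pa) (cong suc (card-remove {p′} b (keep {p} pb b≢a)))
  ... | c , q with kept {λ x → p x ∧ not (does (x ≟ a))} {c} {b} q
  ... | q′ , c≢b with kept {p} {c} {a} q′
  ... | pc , c≢a = c , pc , c≢a , c≢b

-- Connectivity and circuits

-- Warshall's algorithm: Via xs u v says that v is reached from u with all
-- intermediate vertices in xs.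

module _ {V : Set} (fV : Finite V) {R : V → V → Set} (R? : Decidable₂ R) where
  open Finite fV

  private
    Via : List V → V → V → Set
    Via []       u v = u ≡ v ⊎ R u v
    Via (x ∷ xs) u v = Via xs u v ⊎ (Via xs u x × Via xs x v)

    via? : ∀ xs u v → Dec (Via xs u v)
    via? []       u v = (u ≟ v) ⊎-dec R? u v
    via? (x ∷ xs) u v = via? xs u v ⊎-dec (via? xs u x ×-dec via? xs x v)

    via⇒star : ∀ xs {u v} → Via xs u v → Star R u v
    via⇒star []       (inj₁ refl)    = ε
    via⇒star []       (inj₂ r)       = r ◅ ε
    via⇒star (x ∷ xs) (inj₁ p)       = via⇒star xs p
    via⇒star (x ∷ xs) (inj₂ (p , q)) = via⇒star xs p ◅◅ via⇒star xs q

    via-base : ∀ xs {u v} → u ≡ v ⊎ R u v → Via xs u v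
    via-base []       p = p
    via-base (x ∷ xs) p = inj₁ (via-base xs p)

    via-trans : ∀ {xs u v w} → w ∈ xs → Via xs u w → Via xs w v → Via xs u v
    -- If w is the head x itself, the closed parts of both walks at x are dropped; what remains has
    -- all its intermediate vertices in xs.
    via-trans (here refl) p q = inj₂ (to-x p , from-x q)
      where
      to-x : ∀ {x xs u} → Via (x ∷ xs) u x → Via xs u x
      to-x (inj₁ p)       = p
      to-x (inj₂ (p , _)) = p
      from-x : ∀ {x xs v} → Via (x ∷ xs) x v → Via xs x v
      from-x (inj₁ q)       = q
      from-x (inj₂ (_ , q)) = q
    via-trans (there w∈) (inj₁ p)       (inj₁ q)        = inj₁ (via-trans w∈ p q)
    via-trans (there w∈) (inj₁ p)       (inj₂ (q , q′)) = inj₂ (via-trans w∈ p q , q′)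
    via-trans (there w∈) (inj₂ (p , p′)) (inj₁ q)       = inj₂ (p , via-trans w∈ p′ q)
    via-trans (there w∈) (inj₂ (p , _)) (inj₂ (_ , q))  = inj₂ (p , q)

    star⇒via : ∀ {u v} → Star R u v → Via elements u v
    star⇒via ε                 = via-base elements (inj₁ refl)
    star⇒via (_◅_ {_} {w} r s) = via-trans (complete w) (via-base elements (inj₂ r)) (star⇒via s)

  -- The vertex and edge sets of a `Subgraph` are Boolean, so deciding reachability is what makes it
  -- possible to write a component down.
  star? : Decidable₂ (Star R)
  star? u v = map′ (via⇒star elements) star⇒via (via? elements u v)

module GraphLemmas (G : Graph) where
  open Graph G
  open Subgraph

  inc : V → E → Bool
  inc v e = does (incident? v e)

  inc⁺ : ∀ {v e} → Incident v e → inc v e ≡ true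
  inc⁺ {v} {e} = dec-true (incident? v e)

  inc⁻ : ∀ {v e} → inc v e ≡ true → Incident v e
  inc⁻ {v} {e} = does-sound (incident? v e)

  inc-xor : ∀ v e → inc v e ≡ does (v FV.≟ proj₁ (ends e)) xor does (v FV.≟ proj₂ (ends e))
  inc-xor v e with v FV.≟ proj₁ (ends e) | v FV.≟ proj₂ (ends e)
  ... | yes p | yes q = ⊥-elim (loopless e (trans (sym p) q))
  ... | yes _ | no _  = refl
  ... | no _  | yes _ = refl
  ... | no _  | no _  = refl

  -- Double counting mod 2: an edge with both ends in W is counted twice and drops out, so the
  -- degree sum over W has the parity of the edge boundary of W. Looplessness enters through
  -- `inc-xor`.
  handshake : ∀ (W : V → Bool) (f : E → Bool) →
    parity (λ v → W v ∧ parity (λ e → f e ∧ inc v e) FE.elements) FV.elements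
      ≡ parity (λ e → f e ∧ (W (proj₁ (ends e)) xor W (proj₂ (ends e)))) FE.elements
  handshake W f = begin
    parity (λ v → W v ∧ parity (λ e → f e ∧ inc v e) FE.elements) FV.elements
      ≡⟨ parity-cong (λ v → sym (parity-∧ˡ (W v) _ FE.elements)) FV.elements ⟩
    parity (λ v → parity (λ e → W v ∧ (f e ∧ inc v e)) FE.elements) FV.elements
      ≡⟨ parity-swap _ FV.elements FE.elements ⟩
    parity (λ e → parity (λ v → W v ∧ (f e ∧ inc v e)) FV.elements) FE.elements
      ≡⟨ parity-cong at-edge FE.elements ⟩
    parity (λ e → f e ∧ (W (proj₁ (ends e)) xor W (proj₂ (ends e)))) FE.elements ∎
    where
    open ≡-Reasoning
    at-edge : ∀ e → parity (λ v → W v ∧ (f e ∧ inc v e)) FV.elements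
                  ≡ f e ∧ (W (proj₁ (ends e)) xor W (proj₂ (ends e)))
    at-edge e = begin
      parity (λ v → W v ∧ (f e ∧ inc v e)) FV.elements
        ≡⟨ parity-cong (λ v → trans (cong (λ b → W v ∧ (f e ∧ b)) (inc-xor v e))
             (solve 4 (λ w c a b → w :* (c :* (a :+ b)) := c :* (a :* w :+ b :* w)) refl
               (W v) (f e) (does (v FV.≟ a)) (does (v FV.≟ b)))) FV.elements ⟩
      parity (λ v → f e ∧ (does (v FV.≟ a) ∧ W v xor does (v FV.≟ b) ∧ W v)) FV.elements
        ≡⟨ parity-∧ˡ (f e) _ FV.elements ⟩
      f e ∧ parity (λ v → does (v FV.≟ a) ∧ W v xor does (v FV.≟ b) ∧ W v) FV.elements
        ≡⟨ cong (f e ∧_) (parity-xor _ _ FV.elements) ⟩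
      f e ∧ (parity (λ v → does (v FV.≟ a) ∧ W v) FV.elements xor parity (λ v → does (v FV.≟ b) ∧ W v) FV.elements)
        ≡⟨ cong (f e ∧_) (cong₂ _xor_ (parity-pick V-finite a W) (parity-pick V-finite b W)) ⟩
      f e ∧ (W a xor W b) ∎
      where
      a = proj₁ (ends e)
      b = proj₂ (ends e)
      open xor-∧-Solver

  joins⇒incidentˡ : ∀ {e u v} → Joins e u v → Incident u e
  joins⇒incidentˡ (inj₁ eq) = inj₁ (sym (cong proj₁ eq))
  joins⇒incidentˡ (inj₂ eq) = inj₂ (sym (cong proj₂ eq))

  joins⇒incidentʳ : ∀ {e u v} → Joins e u v → Incident v e
  joins⇒incidentʳ = joins⇒incidentˡ ∘ Sum.swap

  incident⇒end : ∀ {e u v w} → Joins e u v → Incident w e → w ≡ u ⊎ w ≡ v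
  incident⇒end (inj₁ eq) (inj₁ p) = inj₁ (trans p (cong proj₁ eq))
  incident⇒end (inj₁ eq) (inj₂ p) = inj₂ (trans p (cong proj₂ eq))
  incident⇒end (inj₂ eq) (inj₁ p) = inj₂ (trans p (cong proj₁ eq))
  incident⇒end (inj₂ eq) (inj₂ p) = inj₁ (trans p (cong proj₂ eq))

  other-end : ∀ {e v} → Incident v e → ∃ λ u → Joins e v u × v ≢ u
  other-end {e} (inj₁ refl) = _ , inj₁ refl , loopless e
  other-end {e} (inj₂ refl) = _ , inj₂ refl , loopless e ∘ sym

  joins-xor : ∀ {e u w} → Joins e u w → ∀ (W : V → Bool) → W (proj₁ (ends e)) xor W (proj₂ (ends e)) ≡ W u xor W w
  joins-xor (inj₁ eq) W = cong₂ (λ a b → W a xor W b) (cong proj₁ eq) (cong proj₂ eq)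
  joins-xor (inj₂ eq) W = trans (cong₂ (λ a b → W a xor W b) (cong proj₁ eq) (cong proj₂ eq)) (xor-comm (W _) (W _))

  adjacent? : ∀ (K : Subgraph G) → Decidable₂ (Adjacent K)
  adjacent? K u v = map′
    (λ p → let e , _ , q = find p in e , q)
    (λ (e , q) → lose (FE.complete e) q)
    (any? (λ e → T? (es K e) ×-dec (Product.≡-dec FV._≟_ FV._≟_ (ends e) (u , v) ⊎-dec Product.≡-dec FV._≟_ FV._≟_ (ends e) (v , u))) FE.elements)

  reach? : ∀ (K : Subgraph G) → Decidable₂ (Star (Adjacent K))
  reach? K = star? V-finite (adjacent? K)

  adjacent-sym : ∀ (K : Subgraph G) {u v} → Adjacent K u v → Adjacent K v u
  adjacent-sym K (e , e∈ , j) = e , e∈ , Sum.swap j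

  star-sym : ∀ (K : Subgraph G) {u v} → Star (Adjacent K) u v → Star (Adjacent K) v u
  star-sym K = Star.reverse {T = Adjacent K} {U = Adjacent K} (adjacent-sym K)

  star-mono : ∀ (K L : Subgraph G) → K ⊆ L → ∀ {u v} → Star (Adjacent K) u v → Star (Adjacent L) u v
  star-mono K L K⊆L = Star.map λ (e , e∈ , j) → e , proj₂ K⊆L e e∈ , j

  module _ (K : Subgraph G) (v : V) (v∈K : hasV K v) where

    private
      reached : V → Bool
      reached u = does (reach? K v u)

    -- Testing one end of an edge suffices, since the edge itself leads from there to the other end.
    component : Subgraph G
    component = record
      { vs     = λ u → vs K u ∧ reached u
      ; es     = λ e → es K e ∧ reached (proj₁ (ends e))
      ; closed = cl
      }
      where
      cl : ∀ {u e} → T (es K e ∧ reached (proj₁ (ends e))) → Incident u e → T (vs K u ∧ reached u)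
      cl {u} {e} e∈ i with ∧-true {es K e} (≡true e∈)
      cl {u} {e} e∈ i | p , q = true≡ (∧-intro (≡true (closed K (true≡ p) i)) (dec-true (reach? K v u) (reaches i)))
        where
        first : Star (Adjacent K) v (proj₁ (ends e))
        first = does-sound (reach? K v (proj₁ (ends e))) q
        reaches : ∀ {u} → Incident u e → Star (Adjacent K) v u
        reaches (inj₁ refl) = first
        reaches (inj₂ refl) = first ◅◅ ((e , true≡ p , inj₁ refl) ◅ ε)

    component-vertex : hasV component v
    component-vertex = true≡ (∧-intro (≡true v∈K) (dec-true (reach? K v v) ε))

    private
      reach⁻ : ∀ {u} → hasV component u → Star (Adjacent K) v u
      reach⁻ {u} u∈ = does-sound (reach? K v u) (proj₂ (∧-true {vs K u} (≡true u∈)))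

      lift : ∀ {a b} → Star (Adjacent K) v a → Star (Adjacent K) a b → Star (Adjacent component) a b
      lift r ε = ε
      lift {a} r (_◅_ {_} {c} (e , e∈ , j) s) =
        (e , true≡ (∧-intro (≡true e∈) (dec-true (reach? K v _) (first j))) , j) ◅ lift (r ◅◅ ((e , e∈ , j) ◅ ε)) s
        where
        first : ∀ {c} → Joins e a c → Star (Adjacent K) v (proj₁ (ends e))
        first (inj₁ eq) = subst (Star (Adjacent K) v) (sym (cong proj₁ eq)) r
        first {c} (inj₂ eq) = subst (Star (Adjacent K) v) (sym (cong proj₁ eq)) (r ◅◅ ((e , e∈ , inj₂ eq) ◅ ε))

    component-isComponent : IsComponent component K
    component-isComponent = ⊆K , connected , maximal
      where
      ⊆K : component ⊆ K
      ⊆K = (λ u u∈ → true≡ (proj₁ (∧-true {vs K u} (≡true u∈)))) , (λ e e∈ → true≡ (proj₁ (∧-true {es K e} (≡true e∈))))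
      connected : Connected component
      connected = (v , component-vertex) , λ u w u∈ w∈ → lift (reach⁻ u∈) (star-sym K (reach⁻ u∈) ◅◅ reach⁻ w∈)
      maximal : ∀ D → component ⊆ D → D ⊆ K → Connected D → D ⊆ component
      maximal D C⊆D D⊆K (_ , conn) = vertex , edge
        where
        reached-D : ∀ u → hasV D u → reached u ≡ true
        reached-D u u∈ = dec-true (reach? K v u) (star-mono D K D⊆K (conn v u (proj₁ C⊆D v component-vertex) u∈))
        vertex : ∀ u → hasV D u → hasV component u
        vertex u u∈ = true≡ (∧-intro (≡true (proj₁ D⊆K u u∈)) (reached-D u u∈))
        edge : ∀ e → hasE D e → hasE component e
        edge e e∈ = true≡ (∧-intro (≡true (proj₂ D⊆K e e∈)) (reached-D _ (closed D e∈ (inj₁ refl))))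

    component-edge : ∀ {u e} → hasV component u → hasE K e → Incident u e → hasE component e
    component-edge {u} {e} u∈ e∈ i = true≡ (∧-intro (≡true e∈) (dec-true (reach? K v _) (first i)))
      where
      -- The membership of u is passed as an instance argument, so that it is rewritten along with u
      -- when the incidence is matched with `refl`.
      first : ∀ {u} → {{hasV component u}} → Incident u e → Star (Adjacent K) v (proj₁ (ends e))
      first {{u∈}} (inj₁ refl) = reach⁻ u∈
      first {{u∈}} (inj₂ refl) = reach⁻ u∈ ◅◅ ((e , e∈ , inj₂ refl) ◅ ε)
      instance
        _ = u∈

  -- C is connected, so it lies in the component D built from one of its vertices u; maximality of C
  -- then gives D ⊆ C, and D contains every edge of K at its vertices.
  isComponent-edge : ∀ (C K : Subgraph G) → IsComponent C K → ∀ {u e} → hasV C u → hasE K e → Incident u e → hasE C e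
  isComponent-edge C K (C⊆K , (_ , conn) , maximal) {u} {e} u∈ e∈ i =
    proj₂ (maximal D C⊆D D⊆K D-conn) e (component-edge K u u∈K (component-vertex K u u∈K) e∈ i)
    where
    u∈K = proj₁ C⊆K u u∈
    D = component K u u∈K
    D⊆K = proj₁ (component-isComponent K u u∈K)
    D-conn = proj₁ (proj₂ (component-isComponent K u u∈K))
    reached : ∀ w → hasV C w → does (reach? K u w) ≡ true
    reached w w∈ = dec-true (reach? K u w) (star-mono C K C⊆K (conn u w u∈ w∈))
    C⊆D : C ⊆ D
    C⊆D = (λ w w∈ → true≡ (∧-intro (≡true (proj₁ C⊆K w w∈)) (reached w w∈)))
        , (λ f f∈ → true≡ (∧-intro (≡true (proj₂ C⊆K f f∈)) (reached _ (closed C f∈ (inj₁ refl)))))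

  isComponent-degree : ∀ (C K : Subgraph G) → IsComponent C K → ∀ {u} → hasV C u → degree C u ≡ degree K u
  isComponent-degree C K comp {u} u∈ = card-cong same FE.elements
    where
    same : ∀ e → es C e ∧ inc u e ≡ es K e ∧ inc u e
    same e with inc u e in i | es C e in c | es K e in k
    ... | false | _     | _     = trans (∧-zeroʳ _) (sym (∧-zeroʳ _))
    ... | true  | true  | true  = refl
    ... | true  | false | false = refl
    ... | true  | true  | false = ⊥-elim (true≢false (≡true (proj₂ (proj₁ comp) e (true≡ c))) k)
    ... | true  | false | true  = ⊥-elim (true≢false (≡true (isComponent-edge C K comp u∈ (true≡ k) (inc⁻ i))) c)

  -- In a connected 2-regular C, take the component W of C − v that contains u.
  -- By the handshake lemma the number of edges from W to v is even, and it is
  -- positive, so both edges at v lead to W and nothing else is left of C − v.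

  module _ (C : Subgraph G) (regular : Regular 2 C) (conn : Connected C) (v : V) (v∈C : hasV C v) where
    private
      N : Subgraph G
      N = deleteVertex C v

      N⁺ : ∀ {u} → hasV C u → u ≢ v → hasV N u
      N⁺ {u} u∈ u≢v = true≡ (∧-intro (≡true u∈) (cong not (dec-false (u FV.≟ v) u≢v)))

      N⁻ : ∀ {u} → hasV N u → hasV C u × u ≢ v
      N⁻ {u} u∈ with ∧-true {vs C u} (≡true u∈)
      ... | p , q = true≡ p , λ u≡v → true≢false q (cong not (dec-true (u FV.≟ v) u≡v))

      N-edge : ∀ {e u w} → hasE C e → Joins e u w → u ≢ v → w ≢ v → hasE N e
      N-edge {e} e∈ j u≢v w≢v = true≡ (∧-intro (≡true e∈) (cong not (dec-false (incident? v e) avoid)))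
        where
        avoid : ¬ Incident v e
        avoid i with incident⇒end j i
        ... | inj₁ eq = u≢v (sym eq)
        ... | inj₂ eq = w≢v (sym eq)

      -- The walk is cut at its first visit to v; the part before the last step of that initial walk
      -- stays in N.
      approach : ∀ {u} → Star (Adjacent C) u v → u ≢ v → ∃ λ a → Star (Adjacent N) u a × Adjacent C a v
      approach ε u≢v = ⊥-elim (u≢v refl)
      approach {u} (_◅_ {_} {w} (e , e∈ , j) s) u≢v with w FV.≟ v
      ... | yes refl = u , ε , e , e∈ , j
      ... | no w≢v with approach s w≢v
      ... | a , r , adj = a , (e , N-edge e∈ j u≢v w≢v , j) ◅ r , adj

    deleteVertex-connected : Connected N
    deleteVertex-connected = nonempty , connected
      where
      nonempty : ∃ (hasV N)
      nonempty with card-witness (λ e → es C e ∧ inc v e) FE.elements (subst (1 ≤_) (sym (regular v v∈C)) (s≤s z≤n))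
      ... | e , p with ∧-true {es C e} p
      ... | e∈ , i with other-end (inc⁻ i)
      ... | u , j , v≢u = u , N⁺ (closed C (true≡ e∈) (joins⇒incidentʳ j)) (v≢u ∘ sym)

      connected : ∀ u w → hasV N u → hasV N w → Star (Adjacent N) u w
      connected u w u∈ w∈ with reach? N u w
      ... | yes s = s
      ... | no ¬s = ⊥-elim (impossible (approach (to-v u u∈) (proj₂ (N⁻ u∈))) (approach (to-v w w∈) (proj₂ (N⁻ w∈))))
        where
        to-v : ∀ u → hasV N u → Star (Adjacent C) u v
        to-v u u∈ = proj₂ conn u v (proj₁ (N⁻ u∈)) v∈C

        W : V → Bool
        W x = vs N x ∧ does (reach? N u x)

        at-v q : E → Bool
        at-v e = es C e ∧ inc v e
        q e = es C e ∧ (W (proj₁ (ends e)) xor W (proj₂ (ends e)))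

        W⁺ : ∀ {x} → hasV N x → Star (Adjacent N) u x → W x ≡ true
        W⁺ {x} x∈ s = ∧-intro (≡true x∈) (dec-true (reach? N u x) s)

        W⁻ : ∀ {x} → W x ≡ true → hasV N x × Star (Adjacent N) u x
        W⁻ {x} eq with ∧-true {vs N x} eq
        ... | p , r = true≡ p , does-sound (reach? N u x) r

        W-v : W v ≡ false
        W-v = ≢true⇒≡false λ eq → proj₂ (N⁻ (proj₁ (W⁻ eq))) refl

        even-in-W : ∀ x → W x ∧ parity (λ e → es C e ∧ inc x e) FE.elements ≡ false
        even-in-W x with W x in eq
        ... | false = refl
        ... | true  = trans (parity≡odd _ FE.elements) (cong odd (regular x (proj₁ (N⁻ (proj₁ (W⁻ eq))))))

        q-even : odd (card q FE.elements) ≡ false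
        q-even = trans (sym (parity≡odd q FE.elements))
          (trans (sym (handshake W (es C))) (parity-none even-in-W FV.elements))

        spread : ∀ {e a b} → hasE C e → Joins e a b → a ≢ v → b ≢ v → W a ≡ true → W b ≡ true
        spread e∈ j a≢v b≢v Wa with W⁻ Wa
        ... | a∈ , s = W⁺ (N⁺ (closed C e∈ (joins⇒incidentʳ j)) b≢v) (s ◅◅ ((_ , N-edge e∈ j a≢v b≢v , j) ◅ ε))

        q⇒at-v : ∀ e → q e ≡ true → at-v e ≡ true
        q⇒at-v e qe with ∧-true {es C e} qe
        ... | e∈ , cross with incident? v e
        ... | yes i = ∧-intro e∈ (inc⁺ i)
        ... | no ¬i = ⊥-elim (true≢false cross (same (W a) (W b) refl refl))
          where
          a = proj₁ (ends e)
          b = proj₂ (ends e)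
          a≢v : a ≢ v
          a≢v eq = ¬i (inj₁ (sym eq))
          b≢v : b ≢ v
          b≢v eq = ¬i (inj₂ (sym eq))
          same : ∀ x y → W a ≡ x → W b ≡ y → x xor y ≡ false
          same true  true  _ _ = refl
          same false false _ _ = refl
          same true  false p r = ⊥-elim (true≢false (spread (true≡ e∈) (inj₁ refl) a≢v b≢v p) r)
          same false true  p r = ⊥-elim (true≢false (spread (true≡ e∈) (inj₂ refl) b≢v a≢v r) p)

        impossible : (∃ λ a → Star (Adjacent N) u a × Adjacent C a v) →
                     (∃ λ b → Star (Adjacent N) w b × Adjacent C b v) → ⊥
        impossible (a , u⟶a , e , e∈ , j) (b , w⟶b , f , f∈ , j′) = odd-one (card q FE.elements) ≥1 ≤1 q-even
          where
          a∈N : ∀ {a e} → hasE C e → Joins e a v → hasV N a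
          a∈N {a} {e} e∈ j with other-end (joins⇒incidentʳ j)
          ... | c , j″ , v≢c with incident⇒end j (joins⇒incidentʳ j″)
          ... | inj₁ refl = N⁺ (closed C e∈ (joins⇒incidentˡ j)) (v≢c ∘ sym)
          ... | inj₂ refl = ⊥-elim (v≢c refl)
          q-e : q e ≡ true
          q-e = ∧-intro (≡true e∈) (trans (joins-xor j W) (cong₂ _xor_ (W⁺ (a∈N e∈ j) u⟶a) W-v))
          ¬Wb : W b ≡ false
          ¬Wb = ≢true⇒≡false λ eq → ¬s (proj₂ (W⁻ eq) ◅◅ star-sym N w⟶b)
          q-f : q f ≡ false
          q-f = trans (cong (es C f ∧_) (trans (joins-xor j′ W) (cong₂ _xor_ ¬Wb W-v))) (∧-zeroʳ _)
          -- C has two edges at v, and f is one of them that does not lead to W. So q, which is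
          -- supported at v, has at most one element, and it contains e.
          rest : E → Bool
          rest x = at-v x ∧ not (does (x FE.≟ f))
          q⇒rest : ∀ x → q x ≡ true → rest x ≡ true
          q⇒rest x qx = keep E-finite {at-v} (q⇒at-v x qx) λ { refl → true≢false qx q-f }
          one : card rest FE.elements ≡ 1
          one = ℕ.suc-injective (trans (sym (card-remove E-finite {at-v} f (∧-intro (≡true f∈) (inc⁺ (joins⇒incidentʳ j′))))) (regular v v∈C))
          ≥1 : 1 ≤ card q FE.elements
          ≥1 = card-positive {p = q} (FE.complete e) q-e
          ≤1 : card q FE.elements ≤ 1
          ≤1 = subst (card q FE.elements ≤_) one (card-mono q⇒rest FE.elements)
          odd-one : ∀ n → 1 ≤ n → n ≤ 1 → odd n ≡ false → ⊥
          odd-one (suc zero) _ _ ()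
          odd-one (suc (suc _)) _ (s≤s ()) _

  -- Here a condition on components becomes one on degrees, with `circuits⇒regular` as the way back.
  -- A component keeps the degrees of K, and a connected 2-regular graph has no cut vertex by
  -- `deleteVertex-connected`; the two edges at any vertex rule out K₁ and K₂.
  regular⇒circuits : ∀ (K : Subgraph G) → Regular 2 K → ∀ C → IsComponent C K → IsCircuit C
  regular⇒circuits K regular C comp@(C⊆K , conn@((v , v∈) , _) , _) =
    C-regular , enough-edges , conn , deleteVertex-connected C C-regular conn
    where
    C-regular : Regular 2 C
    C-regular u u∈ = trans (isComponent-degree C K comp u∈) (regular u (proj₁ C⊆K u u∈))
    enough-edges : 2 ≤ ∣E∣ C
    enough-edges = subst (_≤ ∣E∣ C) (C-regular v v∈) (card-mono (λ e p → proj₁ (∧-true {es C e} p)) FE.elements)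

  degree-cong : ∀ (K L : Subgraph G) → K ≈ L → ∀ v → degree K v ≡ degree L v
  degree-cong K L K≈L v = card-cong (λ e → cong (_∧ inc v e) (proj₂ K≈L e)) FE.elements

  circuits⇒regular : ∀ (K : Subgraph G) → (∀ C → IsComponent C K → IsCircuit C) → Regular 2 K
  circuits⇒regular K circuits v v∈ = trans (sym (isComponent-degree (component K v v∈) K comp (component-vertex K v v∈)))
    (proj₁ (circuits (component K v v∈) comp) v (component-vertex K v v∈))
    where comp = component-isComponent K v v∈

  -- The cycle space of `G` over 𝔽₂.
  Even : (E → Bool) → Set
  Even M = ∀ v → parity (λ e → M e ∧ inc v e) FE.elements ≡ false

  regular⇒even : ∀ (K : Subgraph G) → Regular 2 K → Even (es K)
  regular⇒even K regular v with vs K v in eq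
  ... | true  = trans (parity≡odd _ FE.elements) (cong odd (regular v (true≡ eq)))
  ... | false = parity-none (λ e → ≢true⇒≡false λ p → let e∈ , i = ∧-true {es K e} p in
                  true≢false (≡true (closed K (true≡ e∈) (inc⁻ i))) eq) FE.elements

  module _ (cubic : Cubic G) where

    even⇒degree-two : ∀ {M} → Even M → ∀ {v e} → M e ≡ true → Incident v e →
      card (λ e → M e ∧ inc v e) FE.elements ≡ 2
    even⇒degree-two {M} even {v} {e} e∈ i = two _ ≥1 ≤3 (trans (sym (parity≡odd _ FE.elements)) (even v))
      where
      ≥1 : 1 ≤ card (λ e → M e ∧ inc v e) FE.elements
      ≥1 = card-positive {p = λ e → M e ∧ inc v e} (FE.complete e) (∧-intro e∈ (inc⁺ i))
      ≤3 : card (λ e → M e ∧ inc v e) FE.elements ≤ 3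
      ≤3 = subst (card (λ e → M e ∧ inc v e) FE.elements ≤_) (cubic v _) (card-mono (λ e p → proj₂ (∧-true {M e} p)) FE.elements)
      two : ∀ n → 1 ≤ n → n ≤ 3 → odd n ≡ false → n ≡ 2
      two 2 _ _ _ = refl
      two 1 _ _ ()
      two 3 _ _ ()
      two (suc (suc (suc (suc _)))) _ (s≤s (s≤s (s≤s ()))) _

    even⇒regular : ∀ {M} → Even M → Regular 2 (edgeInduced G M)
    even⇒regular {M} even v v∈ with find (Any.any⁻ (λ e → M e ∧ inc v e) FE.elements v∈)
    ... | e , _ , p with ∧-true {M e} (≡true p)
    ... | e∈ , i = even⇒degree-two even e∈ (inc⁻ i)

    -- Two disjoint pairs of edges do not fit at a vertex of degree 3.

    even-meets-two-factor : ∀ {M} → Even M → ∀ (K : Subgraph G) → IsTwoFactor K → ∀ {e} → M e ≡ true →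
      ∃ λ f → M f ≡ true × es K f ≡ true
    even-meets-two-factor {M} even K (spanning , regular) {e} e∈
      with card-witness (λ f → (M f ∧ inc v f) ∧ (es K f ∧ inc v f)) FE.elements (remainder _ _ four ≤3)
      where
      v = proj₁ (ends e)
      p q : E → Bool
      p f = M f ∧ inc v f
      q f = es K f ∧ inc v f
      four : card (λ f → p f ∨ q f) FE.elements + card (λ f → p f ∧ q f) FE.elements ≡ 4
      four = trans (card-∨-∧ p q FE.elements) (cong₂ _+_ (even⇒degree-two even e∈ (inj₁ refl)) (regular v (spanning v)))
      ≤3 : card (λ f → p f ∨ q f) FE.elements ≤ 3
      ≤3 = subst (card (λ f → p f ∨ q f) FE.elements ≤_) (cubic v _) (card-mono at-v FE.elements)
        where
        at-v : ∀ f → p f ∨ q f ≡ true → inc v f ≡ true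
        at-v f eq with inc v f | M f | es K f
        ... | true  | _     | _     = refl
        at-v f () | false | true  | true
        at-v f () | false | true  | false
        at-v f () | false | false | true
        at-v f () | false | false | false
      remainder : ∀ m n → m + n ≡ 4 → m ≤ 3 → 1 ≤ n
      remainder m (suc n) _ _ = s≤s z≤n
      remainder m zero eq m≤3 with () ← ℕ.1+n≰n (subst (_≤ 3) (trans (sym (ℕ.+-identityʳ m)) eq) m≤3)
    ... | f , eq with ∧-true {M f ∧ inc (proj₁ (ends e)) f} eq
    ... | p , q = f , proj₁ (∧-true {M f} p) , proj₁ (∧-true {es K f} q)

-- Pieces and the graph H

xor-false : ∀ {a b} → a xor b ≡ false → a ≡ b
xor-false {true}  {true}  _ = refl
xor-false {false} {false} _ = refl

module _ {A : Set} {P : A → Set} (P? : Decidable P) (fA : Finite A) where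
  private
    fP = refinement-finite P? fA
    module A = Finite fA
    module P = Finite fP

  extend : ([ a ∈ A ∣ P a ] → Bool) → A → Bool
  extend m a with P? a
  ... | yes p = m (a Refinement., [ p ])
  ... | no _  = false

  extend-value : ∀ m c → extend m (value c) ≡ m c
  extend-value m (a Refinement., [ p ]) with P? a
  ... | yes _ = refl
  ... | no ¬p = ⊥-elim-irr (¬p p)

  extend-absent : ∀ m {a} → ¬ P a → extend m a ≡ false
  extend-absent m {a} ¬p with P? a
  ... | yes p = ⊥-elim (¬p p)
  ... | no _  = refl

  -- Proofs being irrelevant, `value` is a bijection onto the elements that satisfy P. Inserting the
  -- sum over its fibres and exchanging the two sums transfers the parity.
  parity-extend : ∀ m (h : A → Bool) →
    parity (λ a → extend m a ∧ h a) A.elements ≡ parity (λ c → m c ∧ h (value c)) P.elements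
  parity-extend m h = begin
    parity g A.elements
      ≡⟨ parity-cong fibre A.elements ⟨
    parity (λ a → parity (λ c → does (a A.≟ value c) ∧ g a) P.elements) A.elements
      ≡⟨ parity-swap _ A.elements P.elements ⟩
    parity (λ c → parity (λ a → does (a A.≟ value c) ∧ g a) A.elements) P.elements
      ≡⟨ parity-cong (λ c → trans (parity-pick fA (value c) g) (cong (_∧ h (value c)) (extend-value m c))) P.elements ⟩
    parity (λ c → m c ∧ h (value c)) P.elements ∎
    where
    open ≡-Reasoning
    g : A → Bool
    g a = extend m a ∧ h a
    fibre : ∀ a → parity (λ c → does (a A.≟ value c) ∧ g a) P.elements ≡ g a
    fibre a with P? a in eq
    ... | yes p = trans (parity-∧ʳ _ _ P.elements) (cong (_∧ (m (a Refinement., [ p ]) ∧ h a))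
            (trans (parity-cong (λ c → does-sym fA a (value c)) P.elements) (parity-singleton fP (a Refinement., [ p ]))))
    ... | no ¬p = parity-none (λ c → ∧-zeroʳ _) P.elements

parity-Σ : ∀ {A : Set} {B : A → Set} (fA : Finite A) (fB : ∀ a → Finite (B a)) (g : Σ A B → Bool) →
  parity g (Finite.elements (Σ-finite fA fB))
    ≡ parity (λ a → parity (λ b → g (a , b)) (Finite.elements (fB a))) (Finite.elements fA)
parity-Σ {A} {B} fA fB g = go (Finite.elements fA)
  where
  fibre : (a : A) → List (Σ A B)
  fibre a = map (a ,_) (Finite.elements (fB a))
  go : ∀ as → parity g (concatMap fibre as) ≡ parity (λ a → parity (λ b → g (a , b)) (Finite.elements (fB a))) as
  go []       = refl
  go (a ∷ as) = trans (parity-++ g (fibre a) _) (cong₂ _xor_ (parity-map g (a ,_) (Finite.elements (fB a))) (go as))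

halfEdges : List HalfEdge
halfEdges = e₁ ∷ e₂ ∷ e₃ ∷ e₄ ∷ e₅ ∷ e₆ ∷ []

module _ (P : Piece) where
  open Piece P

  isCoreEdge? : Decidable (IsCoreEdge P)
  isCoreEdge? e = ¬? (e FE.≟ x₁x₂) ×-dec ¬? (incident? z₁ e) ×-dec ¬? (incident? z₂ e)

  core : Graph
  core = record
    { V        = CoreV P
    ; E        = CoreE P
    ; V-finite = CoreV-finite P
    ; E-finite = CoreE-finite P
    ; ends     = coreEnds P
    ; loopless = λ e → loopless (value e) ∘ cong value
    }

  core-inc : ∀ v e → GraphLemmas.inc core v e ≡ GraphLemmas.inc Q (value v) (value e)
  core-inc v e = does-⇔ (mk⇔ (Sum.map (cong value) (cong value)) (Sum.map value-injective value-injective))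
    (Graph.incident? core v e) (incident? (value v) (value e))

  private
    module C = Graph core
    module L = GraphLemmas core

  attached : CoreV P → HalfEdge → Bool
  attached v j = does (v C.FV.≟ attach P j)

  -- Evenness in Q̃ at a core vertex, for the core edges in f and the half-edges in h. At x₂ both
  -- `e₂` and `e₃` count.
  EvenAt : (CoreE P → Bool) → (HalfEdge → Bool) → CoreV P → Set
  EvenAt f h v =
    parity (λ e → f e ∧ L.inc v e) C.FE.elements xor parity (λ j → h j ∧ attached v j) halfEdges ≡ false

  -- Summing over the core, every core edge is counted at both ends.

  halfEdges-even : ∀ f h → (∀ v → EvenAt f h v) → parity h halfEdges ≡ false
  halfEdges-even f h even = begin
    parity h halfEdges
      ≡⟨ parity-cong (λ j → trans (sym (Bool.∧-identityʳ (h j))) (trans (cong (h j ∧_) (sym (parity-singleton C.V-finite (attach P j))))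
           (sym (parity-∧ˡ (h j) (λ v → attached v j) C.FV.elements)))) halfEdges ⟩
    parity (λ j → parity (λ v → h j ∧ attached v j) C.FV.elements) halfEdges
      ≡⟨ parity-swap (λ j v → h j ∧ attached v j) halfEdges C.FV.elements ⟩
    parity (λ v → parity (λ j → h j ∧ attached v j) halfEdges) C.FV.elements
      ≡⟨ parity-cong (λ v → xor-false (even v)) C.FV.elements ⟨
    parity (λ v → parity (λ e → f e ∧ L.inc v e) C.FE.elements) C.FV.elements
      ≡⟨ L.handshake (λ _ → true) f ⟩
    parity (λ e → f e ∧ false) C.FE.elements
      ≡⟨ parity-none (λ e → ∧-zeroʳ (f e)) C.FE.elements ⟩
    false ∎
    where open ≡-Reasoning

Connector : Set
Connector = Fin (length gluings) ⊎ Fin (length pendants) ⊎ ⊤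

connector-finite : Finite Connector
connector-finite = ⊎-finite (Fin-finite _) (⊎-finite (Fin-finite _) ⊤-finite)

-- The element of `gluings` or `pendants` carrying the label eⁱⱼ.

halfEdge : Fin 4 → HalfEdge → Connector
halfEdge #1 e₁ = inj₁ (# 0)
halfEdge #1 e₂ = inj₂ (inj₁ (# 0))
halfEdge #1 e₃ = inj₁ (# 1)
halfEdge #1 e₄ = inj₁ (# 6)
halfEdge #1 e₅ = inj₁ (# 7)
halfEdge #1 e₆ = inj₁ (# 8)
halfEdge #2 e₁ = inj₁ (# 6)
halfEdge #2 e₂ = inj₁ (# 7)
halfEdge #2 e₃ = inj₂ (inj₁ (# 2))
halfEdge #2 e₄ = inj₁ (# 4)
halfEdge #2 e₅ = inj₁ (# 5)
halfEdge #2 e₆ = inj₁ (# 9)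
halfEdge #3 e₁ = inj₁ (# 4)
halfEdge #3 e₂ = inj₂ (inj₁ (# 1))
halfEdge #3 e₃ = inj₁ (# 5)
halfEdge #3 e₄ = inj₁ (# 2)
halfEdge #3 e₅ = inj₁ (# 3)
halfEdge #3 e₆ = inj₁ (# 8)
halfEdge #4 e₁ = inj₁ (# 2)
halfEdge #4 e₂ = inj₁ (# 3)
halfEdge #4 e₃ = inj₂ (inj₁ (# 3))
halfEdge #4 e₄ = inj₁ (# 0)
halfEdge #4 e₅ = inj₁ (# 1)
halfEdge #4 e₆ = inj₁ (# 9)

module _ (Q : Fin 4 → Piece) where
  open GraphLemmas (H Q)
  open Graph (H Q)
  private
    module O = Finite connector-finite
    module C i = Graph (core (Q i))

  -- Reduces the fifteen edges outside the cores to a short list js, for all f at once. The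
  -- incidences with w enter only through the hypothesis, whose entries can be checked edge by edge;
  -- d tells which edges of the list end in w.
  connector-parity : ∀ {J : Set} (w : V) (js : List J) (edge : J → Connector) (d : J → Bool) →
    All (λ o → inc w (inj₂ o) ≡ parity (λ j → does (o O.≟ edge j) ∧ d j) js) O.elements →
    ∀ (f : E → Bool) →
    parity (λ o → f (inj₂ o) ∧ inc w (inj₂ o)) O.elements ≡ parity (λ j → f (inj₂ (edge j)) ∧ d j) js
  connector-parity w js edge d table f = begin
    parity (λ o → f (inj₂ o) ∧ inc w (inj₂ o)) O.elements
      ≡⟨ on-all table ⟩
    parity (λ o → f (inj₂ o) ∧ parity (λ j → does (o O.≟ edge j) ∧ d j) js) O.elements
      ≡⟨ parity-cong (λ o → parity-∧ˡ (f (inj₂ o)) (λ j → does (o O.≟ edge j) ∧ d j) js) O.elements ⟨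
    parity (λ o → parity (λ j → f (inj₂ o) ∧ (does (o O.≟ edge j) ∧ d j)) js) O.elements
      ≡⟨ parity-swap (λ o j → f (inj₂ o) ∧ (does (o O.≟ edge j) ∧ d j)) O.elements js ⟩
    parity (λ j → parity (λ o → f (inj₂ o) ∧ (does (o O.≟ edge j) ∧ d j)) O.elements) js
      ≡⟨ parity-cong (λ j → trans (parity-cong (λ o → rotate (f (inj₂ o)) (does (o O.≟ edge j)) (d j)) O.elements)
           (parity-pick connector-finite (edge j) (λ o → f (inj₂ o) ∧ d j))) js ⟩
    parity (λ j → f (inj₂ (edge j)) ∧ d j) js ∎
    where
    open ≡-Reasoning
    on-all : ∀ {g : Connector → Bool} {os} → All (λ o → inc w (inj₂ o) ≡ g o) os →
      parity (λ o → f (inj₂ o) ∧ inc w (inj₂ o)) os ≡ parity (λ o → f (inj₂ o) ∧ g o) os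
    on-all []         = refl
    on-all (eq ∷ eqs) = cong₂ _xor_ (cong (f _ ∧_) eq) (on-all eqs)
    rotate : ∀ a b c → a ∧ (b ∧ c) ≡ b ∧ (a ∧ c)
    rotate a b c = solve 3 (λ a b c → a :* (b :* c) := b :* (a :* c)) refl a b c
      where open xor-∧-Solver

  private
    l : ∀ {b} → b ∨ false ≡ b xor false
    l {true}  = refl
    l {false} = refl

    r : ∀ {b} → b ≡ b xor false
    r = sym (xor-identityʳ _)

    n : false ≡ false
    n = refl

    -- For each edge outside the cores: n if it has no half-edge of the i-th
    -- piece, else l or r, as this half-edge comes first or second.

    attached-table : ∀ i (v : CoreV (Q i)) →
      All (λ o → inc (coreV i v) (inj₂ o) ≡ parity (λ j → does (o O.≟ halfEdge i j) ∧ attached (Q i) v j) halfEdges) O.elements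
    attached-table #1 v = l ∷ l ∷ n ∷ n ∷ n ∷ n ∷ r ∷ r ∷ l ∷ n ∷ l ∷ n ∷ n ∷ n ∷ n ∷ []
    attached-table #2 v = n ∷ n ∷ n ∷ n ∷ r ∷ r ∷ l ∷ l ∷ n ∷ l ∷ n ∷ n ∷ l ∷ n ∷ n ∷ []
    attached-table #3 v = n ∷ n ∷ r ∷ r ∷ l ∷ l ∷ n ∷ n ∷ r ∷ n ∷ n ∷ l ∷ n ∷ n ∷ n ∷ []
    attached-table #4 v = r ∷ r ∷ l ∷ l ∷ n ∷ n ∷ n ∷ n ∷ n ∷ r ∷ n ∷ n ∷ n ∷ l ∷ n ∷ []

  -- This carries evenness from `H` to `EvenAt` in a piece: core edges of the other pieces miss v,
  -- and among the remaining edges only those with a label of the i-th piece can meet it.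
  vertex-parity : ∀ i (v : CoreV (Q i)) (f : E → Bool) →
    parity (λ e → f e ∧ inc (coreV i v) e) FE.elements
      ≡ parity (λ e → f (coreE i e) ∧ GraphLemmas.inc (core (Q i)) v e) (C.FE.elements i)
        xor parity (λ j → f (inj₂ (halfEdge i j)) ∧ attached (Q i) v j) halfEdges
  vertex-parity i v f = begin
    parity g FE.elements
      ≡⟨ parity-++ g (map inj₁ S.elements) (map inj₂ O.elements) ⟩
    parity g (map inj₁ S.elements) xor parity g (map inj₂ O.elements)
      ≡⟨ cong₂ _xor_ (parity-map g inj₁ S.elements) (parity-map g inj₂ O.elements) ⟩
    parity (g ∘ inj₁) S.elements xor parity (g ∘ inj₂) O.elements
      ≡⟨ cong₂ _xor_ on-cores (connector-parity (coreV i v) halfEdges (halfEdge i) (attached (Q i) v) (attached-table i v) f) ⟩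
    parity (λ e → f (coreE i e) ∧ GraphLemmas.inc (core (Q i)) v e) (C.FE.elements i)
      xor parity (λ j → f (inj₂ (halfEdge i j)) ∧ attached (Q i) v j) halfEdges ∎
    where
    open ≡-Reasoning
    module S = Finite (Σ-finite (Fin-finite 4) (λ k → CoreE-finite (Q k)))
    g : E → Bool
    g e = f e ∧ inc (coreV i v) e
    on-core : Fin 4 → Bool
    on-core k = parity (λ e → g (coreE k e)) (C.FE.elements k)

    coreV-injective : ∀ {k u w} → _≡_ {A = V} (coreV k u) (coreV k w) → u ≡ w
    coreV-injective refl = refl

    same-piece : ∀ {k u w} → _≡_ {A = V} (coreV i u) (coreV k w) → k ≡ i
    same-piece refl = refl

    own : on-core i ≡ parity (λ e → f (coreE i e) ∧ GraphLemmas.inc (core (Q i)) v e) (C.FE.elements i)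
    own = parity-cong (λ e → cong (f (coreE i e) ∧_)
      (does-⇔ (mk⇔ (Sum.map coreV-injective coreV-injective) (Sum.map (cong (λ u → coreV i u)) (cong (λ u → coreV i u))))
        (incident? (coreV i v) (coreE i e)) (C.incident? i v e))) (C.FE.elements i)

    foreign : ∀ k → on-core k ≡ does (k Fin.≟ i) ∧ on-core k
    foreign k with k Fin.≟ i
    ... | yes _  = refl
    ... | no k≢i = parity-none (λ e → trans (cong (f (coreE k e) ∧_)
      (dec-false (incident? (coreV i v) (coreE k e)) Sum.[ k≢i ∘ same-piece , k≢i ∘ same-piece ])) (∧-zeroʳ _)) (C.FE.elements k)

    on-cores : parity (g ∘ inj₁) S.elements ≡ parity (λ e → f (coreE i e) ∧ GraphLemmas.inc (core (Q i)) v e) (C.FE.elements i)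
    on-cores = begin
      parity (g ∘ inj₁) S.elements          ≡⟨ parity-Σ (Fin-finite 4) (λ k → CoreE-finite (Q k)) (g ∘ inj₁) ⟩
      parity on-core (allFin 4)             ≡⟨ parity-cong foreign (allFin 4) ⟩
      parity (λ k → does (k Fin.≟ i) ∧ on-core k) (allFin 4) ≡⟨ parity-pick (Fin-finite 4) i on-core ⟩
      on-core i                             ≡⟨ own ⟩
      parity (λ e → f (coreE i e) ∧ GraphLemmas.inc (core (Q i)) v e) (C.FE.elements i) ∎

  poleEdges : Fin 2 → List Connector
  poleEdges pole-p = inj₂ (inj₁ (# 0)) ∷ inj₂ (inj₁ (# 1)) ∷ inj₂ (inj₂ tt) ∷ []
  poleEdges pole-q = inj₂ (inj₁ (# 2)) ∷ inj₂ (inj₁ (# 3)) ∷ inj₂ (inj₂ tt) ∷ []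

  pole-parity : ∀ k (f : E → Bool) →
    parity (λ e → f e ∧ inc (poleV k) e) FE.elements ≡ parity (f ∘ inj₂) (poleEdges k)
  pole-parity k f = begin
    parity g FE.elements
      ≡⟨ parity-++ g (map inj₁ S.elements) (map inj₂ O.elements) ⟩
    parity g (map inj₁ S.elements) xor parity g (map inj₂ O.elements)
      ≡⟨ cong₂ _xor_ (parity-map g inj₁ S.elements) (parity-map g inj₂ O.elements) ⟩
    parity (g ∘ inj₁) S.elements xor parity (g ∘ inj₂) O.elements
      ≡⟨ cong₂ _xor_ (parity-none (λ e → ∧-zeroʳ (f (inj₁ e))) S.elements)
           (connector-parity (poleV k) (poleEdges k) (λ o → o) (λ _ → true) (table k) f) ⟩
    parity (λ o → f (inj₂ o) ∧ true) (poleEdges k)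
      ≡⟨ parity-cong (λ o → Bool.∧-identityʳ _) (poleEdges k) ⟩
    parity (f ∘ inj₂) (poleEdges k) ∎
    where
    open ≡-Reasoning
    module S = Finite (Σ-finite (Fin-finite 4) (λ k → CoreE-finite (Q k)))
    g : E → Bool
    g e = f e ∧ inc (poleV k) e
    table : ∀ k → All (λ o → inc (poleV k) (inj₂ o) ≡ parity (λ j → does (o O.≟ j) ∧ true) (poleEdges k)) O.elements
    table pole-p = refl ∷ refl ∷ refl ∷ refl ∷ refl ∷ refl ∷ refl ∷ refl ∷ refl ∷ refl ∷ refl ∷ refl ∷ refl ∷ refl ∷ refl ∷ []
    table pole-q = refl ∷ refl ∷ refl ∷ refl ∷ refl ∷ refl ∷ refl ∷ refl ∷ refl ∷ refl ∷ refl ∷ refl ∷ refl ∷ refl ∷ refl ∷ []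

  FH-core : ∀ i e → Subgraph.es (FH Q) (coreE i e) ≡ Subgraph.es (Piece.F (Q i)) (value e)
  FH-core #1 e = trans (Bool.∨-identityʳ _) (trans (Bool.∨-identityʳ _) (Bool.∨-identityʳ _))
  FH-core #2 e = trans (Bool.∨-identityʳ _) (Bool.∨-identityʳ _)
  FH-core #3 e = Bool.∨-identityʳ _
  FH-core #4 e = refl

  -- Every case computes. As all are `refl`, the two labels of a glued edge receive the same colour
  -- by definition, so that neighbouring pieces fit together without transport.
  FH-halfEdge : ∀ i j → Subgraph.es (FH Q) (inj₂ (halfEdge i j)) ≡ true
  FH-halfEdge #1 e₁ = refl
  FH-halfEdge #1 e₂ = refl
  FH-halfEdge #1 e₃ = refl
  FH-halfEdge #1 e₄ = refl
  FH-halfEdge #1 e₅ = refl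
  FH-halfEdge #1 e₆ = refl
  FH-halfEdge #2 e₁ = refl
  FH-halfEdge #2 e₂ = refl
  FH-halfEdge #2 e₃ = refl
  FH-halfEdge #2 e₄ = refl
  FH-halfEdge #2 e₅ = refl
  FH-halfEdge #2 e₆ = refl
  FH-halfEdge #3 e₁ = refl
  FH-halfEdge #3 e₂ = refl
  FH-halfEdge #3 e₃ = refl
  FH-halfEdge #3 e₄ = refl
  FH-halfEdge #3 e₅ = refl
  FH-halfEdge #3 e₆ = refl
  FH-halfEdge #4 e₁ = refl
  FH-halfEdge #4 e₂ = refl
  FH-halfEdge #4 e₃ = refl
  FH-halfEdge #4 e₄ = refl
  FH-halfEdge #4 e₅ = refl
  FH-halfEdge #4 e₆ = refl

-- Completing the cover of a piece to a cycle double cover of Q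

card-map : ∀ {A B : Set} (p : B → Bool) (h : A → B) xs →
  length (filterᵇ p (map h xs)) ≡ card (p ∘ h) xs
card-map p h [] = refl
card-map p h (x ∷ xs) with p (h x)
... | true  = cong ℕ.suc (card-map p h xs)
... | false = card-map p h xs

card-filter : ∀ {A : Set} {p q : A → Bool} → (∀ x → p x ≡ true → q x ≡ true) → ∀ xs →
  card p (filterᵇ q xs) ≡ card p xs
card-filter p⇒q [] = refl
card-filter {p = p} {q} p⇒q (x ∷ xs) with q x | p x in eq | p⇒q x
... | true  | true  | _ rewrite eq = cong ℕ.suc (card-filter p⇒q xs)
... | true  | false | _ rewrite eq = card-filter p⇒q xs
... | false | true  | i with () ← i refl
... | false | false | _ = card-filter p⇒q xs

module _ {A : Set} (fA : Finite A) where
  open Finite fA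

  -- A sum of weighted point masses rather than a lookup: `parity-table` is then plain linearity,
  -- and distinct keys matter only for reading off a value in `table-present`.
  table : List (A × Bool) → A → Bool
  table ps a = parity (λ (b , c) → does (a ≟ b) ∧ c) ps

  table-absent : ∀ {a} ps → All (a ≢_) (map proj₁ ps) → table ps a ≡ false
  table-absent []             []        = refl
  table-absent ((b , c) ∷ ps) (a≢b ∷ a∉) = cong₂ _xor_ (cong (_∧ c) (dec-false (_ ≟ b) a≢b)) (table-absent ps a∉)

  table-present : ∀ {a c ps} → Unique (map proj₁ ps) → (a , c) ∈ ps → table ps a ≡ c
  table-present {a} {c} {_ ∷ ps} (a∉ ∷ _) (here refl) =
    trans (cong₂ _xor_ (cong (_∧ c) (does-refl fA a)) (table-absent ps a∉)) (xor-identityʳ c)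
  table-present {a} {c} {(b , d) ∷ ps} (b∉ ∷ u) (there a∈) =
    trans (cong (λ x → (x ∧ d) xor table ps a) (dec-false (a ≟ b) λ { refl → All.lookup b∉ (∈-map⁺ proj₁ a∈) refl }))
      (table-present u a∈)

  parity-table : ∀ ps (h : A → Bool) → parity (λ a → table ps a ∧ h a) elements ≡ parity (λ (b , c) → c ∧ h b) ps
  parity-table []             h = parity-none (λ _ → refl) elements
  parity-table ((b , c) ∷ ps) h = begin
    parity (λ a → ((does (a ≟ b) ∧ c) xor table ps a) ∧ h a) elements
      ≡⟨ parity-cong (λ a → solve 4 (λ x c t h → (x :* c :+ t) :* h := x :* (c :* h) :+ t :* h) refl
           (does (a ≟ b)) c (table ps a) (h a)) elements ⟩
    parity (λ a → (does (a ≟ b) ∧ (c ∧ h a)) xor (table ps a ∧ h a)) elements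
      ≡⟨ parity-xor _ _ elements ⟩
    parity (λ a → does (a ≟ b) ∧ (c ∧ h a)) elements xor parity (λ a → table ps a ∧ h a) elements
      ≡⟨ cong₂ _xor_ (parity-pick fA b (λ a → c ∧ h a)) (parity-table ps h) ⟩
    (c ∧ h b) xor parity (λ (b , c) → c ∧ h b) ps ∎
    where
    open ≡-Reasoning
    open xor-∧-Solver

-- The parity at a vertex v of Q, where Xᵢ = [v = xᵢ] and Zᵢ = [v = zᵢ]: the
-- first summand comes from the core, the second from the six other edges.

balance : ∀ {k₁ k₂ k₃ k₄ k₅ k₆ kₜ} → (k₁ ≡ k₂ × kₜ ≡ k₃) ⊎ (k₁ ≡ k₃ × kₜ ≡ k₂) →
  k₁ xor k₂ xor k₃ xor k₄ xor k₅ xor k₆ xor false ≡ false → ∀ X₁ X₂ X₄ X₅ X₆ Z₁ Z₂ →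
  ((k₁ ∧ X₁) xor (k₂ ∧ X₂) xor (k₃ ∧ X₂) xor (k₄ ∧ X₄) xor (k₅ ∧ X₅) xor (k₆ ∧ X₆) xor false)
    xor ((k₁ ∧ (X₁ xor X₂)) xor (kₜ ∧ (X₂ xor Z₂)) xor (k₆ ∧ (Z₂ xor X₆)) xor (k₄ ∧ (X₄ xor Z₁)) xor (k₅ ∧ (Z₁ xor X₅))
      xor ((kₜ xor k₆) ∧ (Z₁ xor Z₂)) xor false)
    ≡ false
balance {k₁} {k₂} {k₃} {k₄} {k₅} {k₆} {kₜ} st sum X₁ X₂ X₄ X₅ X₆ Z₁ Z₂ =
  trans (arrange st) (trans (cong (Z₁ ∧_) sum) (∧-zeroʳ Z₁))
  where
  open xor-∧-Solver
  -- At x₂ the pairs k₁, kₜ and k₂, k₃ cancel; at the other vertices apart from z₁ each weight meets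
  -- itself. At z₁ there remains k₄ + k₅ + kₜ + k₆, which is the sum over all six half-edges because
  -- k₁ equals k₂ or k₃.
  arrange : (k₁ ≡ k₂ × kₜ ≡ k₃) ⊎ (k₁ ≡ k₃ × kₜ ≡ k₂) →
    ((k₁ ∧ X₁) xor (k₂ ∧ X₂) xor (k₃ ∧ X₂) xor (k₄ ∧ X₄) xor (k₅ ∧ X₅) xor (k₆ ∧ X₆) xor false)
      xor ((k₁ ∧ (X₁ xor X₂)) xor (kₜ ∧ (X₂ xor Z₂)) xor (k₆ ∧ (Z₂ xor X₆)) xor (k₄ ∧ (X₄ xor Z₁)) xor (k₅ ∧ (Z₁ xor X₅))
        xor ((kₜ xor k₆) ∧ (Z₁ xor Z₂)) xor false)
      ≡ Z₁ ∧ (k₁ xor k₂ xor k₃ xor k₄ xor k₅ xor k₆ xor false)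
  arrange (inj₁ (refl , refl)) =
    solve 12 (λ k₂ k₃ k₄ k₅ k₆ X₁ X₂ X₄ X₅ X₆ Z₁ Z₂ →
      (k₂ :* X₁ :+ (k₂ :* X₂ :+ (k₃ :* X₂ :+ (k₄ :* X₄ :+ (k₅ :* X₅ :+ (k₆ :* X₆ :+ con false))))))
      :+ (k₂ :* (X₁ :+ X₂) :+ (k₃ :* (X₂ :+ Z₂) :+ (k₆ :* (Z₂ :+ X₆) :+ (k₄ :* (X₄ :+ Z₁) :+ (k₅ :* (Z₁ :+ X₅)
        :+ ((k₃ :+ k₆) :* (Z₁ :+ Z₂) :+ con false))))))
      := Z₁ :* (k₂ :+ (k₂ :+ (k₃ :+ (k₄ :+ (k₅ :+ (k₆ :+ con false)))))))
      refl k₂ k₃ k₄ k₅ k₆ X₁ X₂ X₄ X₅ X₆ Z₁ Z₂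
  arrange (inj₂ (refl , refl)) =
    solve 12 (λ k₂ k₃ k₄ k₅ k₆ X₁ X₂ X₄ X₅ X₆ Z₁ Z₂ →
      (k₃ :* X₁ :+ (k₂ :* X₂ :+ (k₃ :* X₂ :+ (k₄ :* X₄ :+ (k₅ :* X₅ :+ (k₆ :* X₆ :+ con false))))))
      :+ (k₃ :* (X₁ :+ X₂) :+ (k₂ :* (X₂ :+ Z₂) :+ (k₆ :* (Z₂ :+ X₆) :+ (k₄ :* (X₄ :+ Z₁) :+ (k₅ :* (Z₁ :+ X₅)
        :+ ((k₂ :+ k₆) :* (Z₁ :+ Z₂) :+ con false))))))
      := Z₁ :* (k₃ :+ (k₂ :+ (k₃ :+ (k₄ :+ (k₅ :+ (k₆ :+ con false)))))))
      refl k₂ k₃ k₄ k₅ k₆ X₁ X₂ X₄ X₅ X₆ Z₁ Z₂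

-- How many members besides F contain an edge, given whether it lies in F: two in all, F being one
-- of them in the first case.
multiplicity : Bool → ℕ
multiplicity true  = 1
multiplicity false = 2

-- What S ∖ {F} leaves of a CDC S ∋ F in Q̃: n even subgraphs, the half-edge eⱼ
-- belonging to the one with index `colour eⱼ` only.

record Cover (P : Piece) (n : ℕ) : Set where
  field
    member : Fin n → CoreE P → Bool
    colour : HalfEdge → Fin n
    even   : ∀ k v → EvenAt P (member k) (λ j → does (k Fin.≟ colour j)) v
    covers : ∀ e → card (λ k → member k e) (allFin n) ≡ multiplicity (Subgraph.es (Piece.F P) (value e))

  colour-parity : ∀ k → parity (λ j → does (k Fin.≟ colour j)) halfEdges ≡ false
  colour-parity k = halfEdges-even P (member k) (λ j → does (k Fin.≟ colour j)) (even k)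

module PieceLemmas (P : Piece) (cubic : Cubic (Piece.Q P)) {n : ℕ} (cover : Cover P n) where
  open Piece P
  open Cover cover
  open Subgraph
  open GraphLemmas Q
  private
    module L = GraphLemmas (core P)
    module C = Graph (core P)

  private
    x₂z₂ z₂x₆ x₄z₁ z₁x₅ z₁z₂′ : E
    x₂z₂  = proj₁ x₂z₂∈C₁
    z₂x₆  = proj₁ z₂x₆∈C₁
    x₄z₁  = proj₁ x₄z₁∈C₂
    z₁x₅  = proj₁ z₁x₅∈C₂
    z₁z₂′ = proj₁ z₁z₂

    joins-x₂z₂ : Joins x₂z₂ x₂ z₂
    joins-x₂z₂ = proj₂ (proj₂ x₂z₂∈C₁)
    joins-z₂x₆ : Joins z₂x₆ z₂ x₆
    joins-z₂x₆ = proj₂ (proj₂ z₂x₆∈C₁)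
    joins-x₄z₁ : Joins x₄z₁ x₄ z₁
    joins-x₄z₁ = proj₂ (proj₂ x₄z₁∈C₂)
    joins-z₁x₅ : Joins z₁x₅ z₁ x₅
    joins-z₁x₅ = proj₂ (proj₂ z₁x₅∈C₂)
    joins-z₁z₂ : Joins z₁z₂′ z₁ z₂
    joins-z₁z₂ = proj₂ (proj₂ z₁z₂)

    x₁∈ : hasV C₁ x₁
    x₁∈ = closed C₁ x₁x₂∈C₁ (joins⇒incidentˡ x₁x₂-joins)
    x₂∈ : hasV C₁ x₂
    x₂∈ = closed C₁ x₁x₂∈C₁ (joins⇒incidentʳ x₁x₂-joins)
    z₂∈ : hasV C₁ z₂
    z₂∈ = closed C₁ (proj₁ (proj₂ z₂x₆∈C₁)) (joins⇒incidentˡ joins-z₂x₆)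
    x₆∈ : hasV C₁ x₆
    x₆∈ = closed C₁ (proj₁ (proj₂ z₂x₆∈C₁)) (joins⇒incidentʳ joins-z₂x₆)
    x₄∈ : hasV C₂ x₄
    x₄∈ = closed C₂ (proj₁ (proj₂ x₄z₁∈C₂)) (joins⇒incidentˡ joins-x₄z₁)
    z₁∈ : hasV C₂ z₁
    z₁∈ = closed C₂ (proj₁ (proj₂ z₁x₅∈C₂)) (joins⇒incidentˡ joins-z₁x₅)
    x₅∈ : hasV C₂ x₅
    x₅∈ = closed C₂ (proj₁ (proj₂ z₁x₅∈C₂)) (joins⇒incidentʳ joins-z₁x₅)

    apart : ∀ {u v} → hasV C₁ u → hasV C₂ v → u ≢ v
    apart u∈ v∈ refl = disjoint _ u∈ v∈

    x₁≢x₂ : x₁ ≢ x₂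
    x₁≢x₂ with (p ∷ _) ∷ _ ← distinct₁ = p
    x₁≢z₂ : x₁ ≢ z₂
    x₁≢z₂ with (_ ∷ p ∷ _) ∷ _ ← distinct₁ = p
    x₁≢x₆ : x₁ ≢ x₆
    x₁≢x₆ with (_ ∷ _ ∷ p ∷ _) ∷ _ ← distinct₁ = p
    x₂≢z₂ : x₂ ≢ z₂
    x₂≢z₂ with _ ∷ (p ∷ _) ∷ _ ← distinct₁ = p
    x₂≢x₆ : x₂ ≢ x₆
    x₂≢x₆ with _ ∷ (_ ∷ p ∷ _) ∷ _ ← distinct₁ = p
    z₂≢x₆ : z₂ ≢ x₆
    z₂≢x₆ with _ ∷ _ ∷ (p ∷ _) ∷ _ ← distinct₁ = p
    x₄≢z₁ : x₄ ≢ z₁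
    x₄≢z₁ with (p ∷ _) ∷ _ ← distinct₂ = p
    x₄≢x₅ : x₄ ≢ x₅
    x₄≢x₅ with (_ ∷ p ∷ _) ∷ _ ← distinct₂ = p
    z₁≢x₅ : z₁ ≢ x₅
    z₁≢x₅ with _ ∷ (p ∷ _) ∷ _ ← distinct₂ = p

    avoids : ∀ {e u w v} → Joins e u w → v ≢ u → v ≢ w → ¬ Incident v e
    avoids j v≢u v≢w i = Sum.[ v≢u , v≢w ] (incident⇒end j i)

    separates : ∀ {e f v} → Incident v e → ¬ Incident v f → e ≢ f
    separates i ¬i refl = ¬i i

    x₂∉z₂x₆ : ¬ Incident x₂ z₂x₆
    x₂∉z₂x₆ = avoids joins-z₂x₆ x₂≢z₂ x₂≢x₆
    x₂∉x₄z₁ : ¬ Incident x₂ x₄z₁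
    x₂∉x₄z₁ = avoids joins-x₄z₁ (apart x₂∈ x₄∈) (apart x₂∈ z₁∈)
    x₂∉z₁x₅ : ¬ Incident x₂ z₁x₅
    x₂∉z₁x₅ = avoids joins-z₁x₅ (apart x₂∈ z₁∈) (apart x₂∈ x₅∈)
    x₂∉z₁z₂ : ¬ Incident x₂ z₁z₂′
    x₂∉z₁z₂ = avoids joins-z₁z₂ (apart x₂∈ z₁∈) x₂≢z₂

    special : List E
    special = x₁x₂ ∷ x₂z₂ ∷ z₂x₆ ∷ x₄z₁ ∷ z₁x₅ ∷ z₁z₂′ ∷ []

    -- Each edge but the last has an end that all later ones avoid: x₁, x₂, x₆, x₄, x₅ in this
    -- order. Vertices on different circuits are told apart by `apart`.
    special-unique : Unique special
    special-unique =
        (separates i₁ (avoids joins-x₂z₂ x₁≢x₂ x₁≢z₂) ∷ separates i₁ (avoids joins-z₂x₆ x₁≢z₂ x₁≢x₆)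
          ∷ separates i₁ (avoids joins-x₄z₁ (apart x₁∈ x₄∈) (apart x₁∈ z₁∈))
          ∷ separates i₁ (avoids joins-z₁x₅ (apart x₁∈ z₁∈) (apart x₁∈ x₅∈))
          ∷ separates i₁ (avoids joins-z₁z₂ (apart x₁∈ z₁∈) x₁≢z₂) ∷ [])
      ∷ (separates i₂ x₂∉z₂x₆ ∷ separates i₂ x₂∉x₄z₁ ∷ separates i₂ x₂∉z₁x₅ ∷ separates i₂ x₂∉z₁z₂ ∷ [])
      ∷ (separates i₆ (avoids joins-x₄z₁ (apart x₆∈ x₄∈) (apart x₆∈ z₁∈))
          ∷ separates i₆ (avoids joins-z₁x₅ (apart x₆∈ z₁∈) (apart x₆∈ x₅∈))
          ∷ separates i₆ (avoids joins-z₁z₂ (apart x₆∈ z₁∈) (z₂≢x₆ ∘ sym)) ∷ [])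
      ∷ (separates i₄ (avoids joins-z₁x₅ x₄≢z₁ x₄≢x₅) ∷ separates i₄ (avoids joins-z₁z₂ x₄≢z₁ (apart z₂∈ x₄∈ ∘ sym)) ∷ [])
      ∷ (separates i₅ (avoids joins-z₁z₂ (z₁≢x₅ ∘ sym) (apart z₂∈ x₅∈ ∘ sym)) ∷ [])
      ∷ [] ∷ []
      where
      i₁ : Incident x₁ x₁x₂
      i₁ = joins⇒incidentˡ x₁x₂-joins
      i₂ : Incident x₂ x₂z₂
      i₂ = joins⇒incidentˡ joins-x₂z₂
      i₆ : Incident x₆ z₂x₆
      i₆ = joins⇒incidentʳ joins-z₂x₆
      i₄ : Incident x₄ x₄z₁
      i₄ = joins⇒incidentˡ joins-x₄z₁
      i₅ : Incident x₅ z₁x₅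
      i₅ = joins⇒incidentʳ joins-z₁x₅

    at-z₁ : ∀ e → Incident z₁ e → e ≡ x₄z₁ ⊎ e ≡ z₁x₅ ⊎ e ≡ z₁z₂′
    at-z₁ e i with (_ ∷ _ ∷ _ ∷ (a ∷ b ∷ _) ∷ (c ∷ _) ∷ _) ← special-unique =
      card-three E-finite {inc z₁} (cubic z₁ _) (inc⁺ (joins⇒incidentʳ joins-x₄z₁)) (inc⁺ (joins⇒incidentˡ joins-z₁x₅))
        (inc⁺ (joins⇒incidentˡ joins-z₁z₂)) (a ∘ sym) (b ∘ sym) (c ∘ sym) e (inc⁺ i)

    at-z₂ : ∀ e → Incident z₂ e → e ≡ x₂z₂ ⊎ e ≡ z₂x₆ ⊎ e ≡ z₁z₂′
    at-z₂ e i with (_ ∷ (a ∷ _ ∷ _ ∷ b ∷ _) ∷ (_ ∷ _ ∷ c ∷ _) ∷ _) ← special-unique =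
      card-three E-finite {inc z₂} (cubic z₂ _) (inc⁺ (joins⇒incidentʳ joins-x₂z₂)) (inc⁺ (joins⇒incidentˡ joins-z₂x₆))
        (inc⁺ (joins⇒incidentʳ joins-z₁z₂)) (a ∘ sym) (b ∘ sym) (c ∘ sym) e (inc⁺ i)

    -- As Q is cubic, z₁ and z₂ have no edges beyond the three listed for each. Together with
    -- `special-not-core`, this makes `special` exactly the set of edges missing from the core.
    core-or-special : ∀ e → IsCoreEdge P e ⊎ e ∈ special
    core-or-special e with e FE.≟ x₁x₂ | incident? z₁ e | incident? z₂ e
    ... | yes eq | _ | _ = inj₂ (here eq)
    ... | no p | no q | no r = inj₁ (p , q , r)
    core-or-special e | no _ | yes i | _ with at-z₁ e i
    ... | inj₁ eq        = inj₂ (there (there (there (here eq))))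
    ... | inj₂ (inj₁ eq) = inj₂ (there (there (there (there (here eq)))))
    ... | inj₂ (inj₂ eq) = inj₂ (there (there (there (there (there (here eq))))))
    core-or-special e | no _ | no _ | yes i with at-z₂ e i
    ... | inj₁ eq        = inj₂ (there (here eq))
    ... | inj₂ (inj₁ eq) = inj₂ (there (there (here eq)))
    ... | inj₂ (inj₂ eq) = inj₂ (there (there (there (there (there (here eq))))))

    special-not-core : ∀ {e} → e ∈ special → ¬ IsCoreEdge P e
    special-not-core (here refl) (p , _) = p refl
    special-not-core (there (here refl)) (_ , _ , r) = r (joins⇒incidentʳ joins-x₂z₂)
    special-not-core (there (there (here refl))) (_ , _ , r) = r (joins⇒incidentˡ joins-z₂x₆)
    special-not-core (there (there (there (here refl)))) (_ , q , _) = q (joins⇒incidentʳ joins-x₄z₁)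
    special-not-core (there (there (there (there (here refl))))) (_ , q , _) = q (joins⇒incidentˡ joins-z₁x₅)
    special-not-core (there (there (there (there (there (here refl)))))) (_ , q , _) = q (joins⇒incidentˡ joins-z₁z₂)

    F⁺ : ∀ {e} → hasE C₁ e ⊎ hasE C₂ e → es F e ≡ true
    F⁺ {e} p = ≡true (Equivalence.from (T-∨ {es C₁ e}) p)

    z₁z₂∉F : es F z₁z₂′ ≡ false
    z₁z₂∉F = ≢true⇒≡false λ eq → Sum.[ (λ e∈ → disjoint z₁ (closed C₁ e∈ (joins⇒incidentˡ joins-z₁z₂)) z₁∈)
                                     , (λ e∈ → disjoint z₂ z₂∈ (closed C₂ e∈ (joins⇒incidentʳ joins-z₁z₂))) ]
                                     (Equivalence.to (T-∨ {es C₁ z₁z₂′}) (true≡ eq))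

    is : Fin n → HalfEdge → Bool
    is k j = does (k Fin.≟ colour j)

  -- The third edge m at x₂ lies in two members, each containing exactly one
  -- of the half-edges e₂ and e₃.

  colours-separated : colour e₂ ≢ colour e₃
  colours-separated c₂≡c₃ = ℕ.0≢1+n (trans (sym (card-none m∉ (allFin n))) (trans (covers m) (cong multiplicity m∉F)))
    where
    x₁x₂-inc : inc x₂ x₁x₂ ≡ true
    x₁x₂-inc = inc⁺ (joins⇒incidentʳ x₁x₂-joins)
    x₂z₂-inc : inc x₂ x₂z₂ ≡ true
    x₂z₂-inc = inc⁺ (joins⇒incidentˡ joins-x₂z₂)
    x₂z₂≢x₁x₂ : x₂z₂ ≢ x₁x₂
    x₂z₂≢x₁x₂ with (p ∷ _) ∷ _ ← special-unique = p ∘ sym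
    third : ∃ λ m → inc x₂ m ≡ true × m ≢ x₁x₂ × m ≢ x₂z₂
    third = card-third E-finite {inc x₂} (cubic x₂ _) x₁x₂-inc x₂z₂-inc x₂z₂≢x₁x₂
    m₀ : E
    m₀ = proj₁ third
    m₀-inc : Incident x₂ m₀
    m₀-inc = inc⁻ (proj₁ (proj₂ third))
    m₀≢x₁x₂ : m₀ ≢ x₁x₂
    m₀≢x₁x₂ = proj₁ (proj₂ (proj₂ third))
    m₀≢x₂z₂ : m₀ ≢ x₂z₂
    m₀≢x₂z₂ = proj₂ (proj₂ (proj₂ third))
    m₀-core : IsCoreEdge P m₀
    m₀-core = Sum.fromInj₁ (⊥-elim ∘ not-special) (core-or-special m₀)
      where
      not-special : ¬ m₀ ∈ special
      not-special (here eq)                                     = m₀≢x₁x₂ eq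
      not-special (there (here eq))                             = m₀≢x₂z₂ eq
      not-special (there (there (here eq)))                     = separates m₀-inc x₂∉z₂x₆ eq
      not-special (there (there (there (here eq))))             = separates m₀-inc x₂∉x₄z₁ eq
      not-special (there (there (there (there (here eq)))))     = separates m₀-inc x₂∉z₁x₅ eq
      not-special (there (there (there (there (there (here eq)))))) = separates m₀-inc x₂∉z₁z₂ eq
    m : CoreE P
    m = m₀ Refinement., [ m₀-core ]
    m∉F : es F m₀ ≡ false
    m∉F = ≢true⇒≡false λ m∈F → Sum.[ m₀≢x₁x₂ , m₀≢x₂z₂ ]
      (card-two E-finite {λ e → es F e ∧ inc x₂ e} (proj₂ twoFactor x₂ (proj₁ twoFactor x₂))
        (∧-intro (F⁺ (inj₁ x₁x₂∈C₁)) x₁x₂-inc) (∧-intro (F⁺ (inj₁ (proj₁ (proj₂ x₂z₂∈C₁)))) x₂z₂-inc) x₂z₂≢x₁x₂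
        m₀ (∧-intro m∈F (inc⁺ m₀-inc)))
    -- Two of the three edges of Q at x₂ are special, which leaves m as the only core edge there.
    only-m : ∀ e → L.inc (attach P e₂) e ≡ does (e C.FE.≟ m)
    only-m e = does-⇔ (mk⇔ to from) (C.incident? (attach P e₂) e) (e C.FE.≟ m)
      where
      from : e ≡ m → C.Incident (attach P e₂) e
      from refl = L.inc⁻ {attach P e₂} {m} (trans (core-inc P (attach P e₂) m) (inc⁺ m₀-inc))
      value-m : ∀ {e} → .(IsCoreEdge P e) → e ≡ x₁x₂ ⊎ e ≡ x₂z₂ ⊎ e ≡ m₀ → e ≡ m₀
      value-m c (inj₁ eq) = ⊥-elim-irr (special-not-core (here eq) c)
      value-m c (inj₂ (inj₁ eq)) = ⊥-elim-irr (special-not-core (there (here eq)) c)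
      value-m c (inj₂ (inj₂ eq)) = eq
      to : ∀ {e} → C.Incident (attach P e₂) e → e ≡ m
      to {e Refinement., [ c ]} i = value-injective (value-m c
        (card-three E-finite {inc x₂} (cubic x₂ _) x₁x₂-inc x₂z₂-inc (inc⁺ m₀-inc) x₂z₂≢x₁x₂ m₀≢x₁x₂ m₀≢x₂z₂
          e (trans (sym (core-inc P (attach P e₂) (e Refinement., [ c ]))) (L.inc⁺ {attach P e₂} {e Refinement., [ c ]} i))))
    m∉ : ∀ k → member k m ≡ false
    m∉ k = begin
      member k m
        ≡⟨ parity-pick C.E-finite m (member k) ⟨
      parity (λ e → does (e C.FE.≟ m) ∧ member k e) C.FE.elements
        ≡⟨ parity-cong (λ e → trans (cong (_∧ member k e) (sym (only-m e))) (∧-comm _ (member k e))) C.FE.elements ⟩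
      parity (λ e → member k e ∧ L.inc (attach P e₂) e) C.FE.elements
        ≡⟨ xor-false (even k (attach P e₂)) ⟩
      parity (λ j → is k j ∧ attached P (attach P e₂) j) halfEdges
        ≡⟨ at-x₂ ⟩
      false ∎
      where
      open ≡-Reasoning
      at-x₂ : parity (λ j → is k j ∧ attached P (attach P e₂) j) halfEdges ≡ false
      -- Of the six half-edges just `e₂` and `e₃` end in x₂, and with equal colours their
      -- contributions cancel.
      at-x₂ rewrite dec-false (x₂ FV.≟ x₁) (x₁≢x₂ ∘ sym) | dec-true (x₂ FV.≟ x₂) refl
                  | dec-false (x₂ FV.≟ x₄) (apart x₂∈ x₄∈) | dec-false (x₂ FV.≟ x₅) (apart x₂∈ x₅∈)
                  | dec-false (x₂ FV.≟ x₆) x₂≢x₆ | c₂≡c₃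
        = solve 5 (λ a b c d e → a :* con false :+ (b :* con true :+ (b :* con true :+ (c :* con false
            :+ (d :* con false :+ (e :* con false :+ con false))))) := con false) refl
            (is k e₁) (is k e₃) (is k e₄) (is k e₅) (is k e₆)
        where open xor-∧-Solver

  module _ {s t : HalfEdge} (st : (s ≡ e₂ × t ≡ e₃) ⊎ (s ≡ e₃ × t ≡ e₂))
           (c₁≡cₛ : colour e₁ ≡ colour s) (cₜ≢c₆ : colour t ≢ colour e₆) where
    -- Both e₂ and e₃ end in x₂, so either of them may replace x₂z₂, and the
    -- other one x₁x₂.

    private
      weights : Fin n → List (E × Bool)
      weights k = (x₁x₂ , is k e₁) ∷ (x₂z₂ , is k t) ∷ (z₂x₆ , is k e₆) ∷ (x₄z₁ , is k e₄) ∷ (z₁x₅ , is k e₅)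
                ∷ (z₁z₂′ , is k t xor is k e₆) ∷ []

      -- The two summands have disjoint supports, the core and `special`, so the xor merely joins
      -- them; this form makes the parity at a vertex additive.
      M : Fin n → E → Bool
      M k e = extend (isCoreEdge? P) E-finite (member k) e xor table E-finite (weights k) e

      M-special : ∀ k {e c} → (e , c) ∈ weights k → M k e ≡ c
      M-special k e∈ = cong₂ _xor_ (extend-absent (isCoreEdge? P) E-finite (member k) (special-not-core (∈-map⁺ proj₁ e∈)))
        (table-present E-finite special-unique e∈)

      M-core : ∀ k c → M k (value c) ≡ member k c
      M-core k c@(e Refinement., [ p ]) =
        trans (cong₂ _xor_ (extend-value (isCoreEdge? P) E-finite (member k) c)
                (table-absent E-finite (weights k) (All.tabulate λ e∈ → λ { refl → ⊥-elim-irr (special-not-core e∈ p) })))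
          (xor-identityʳ _)

      at : V → HalfEdge → Bool
      at v j = does (v FV.≟ value (attach P j))

      -- Away from z₁ and z₂ this is the evenness of the cover; at these two vertices there are
      -- neither core edges nor half-edges, and both sides vanish.
      core-part : ∀ k v → parity (λ e → extend (isCoreEdge? P) E-finite (member k) e ∧ inc v e) FE.elements
                        ≡ parity (λ j → is k j ∧ at v j) halfEdges
      core-part k v = trans (parity-extend (isCoreEdge? P) E-finite (member k) (inc v)) (by-vertex (v FV.≟ z₁) (v FV.≟ z₂))
        where
        away : (∀ e → .(IsCoreEdge P e) → inc v e ≡ false) → (∀ j → at v j ≡ false) →
          parity (λ c → member k c ∧ inc v (value c)) C.FE.elements ≡ parity (λ j → is k j ∧ at v j) halfEdges
        away no-edge no-half = trans
          (parity-none (λ { c@(e Refinement., [ p ]) → trans (cong (member k c ∧_) (no-edge e p)) (∧-zeroʳ _) }) C.FE.elements)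
          (sym (parity-none (λ j → trans (cong (is k j ∧_) (no-half j)) (∧-zeroʳ _)) halfEdges))
        by-vertex : Dec (v ≡ z₁) → Dec (v ≡ z₂) →
          parity (λ c → member k c ∧ inc v (value c)) C.FE.elements ≡ parity (λ j → is k j ∧ at v j) halfEdges
        by-vertex (yes refl) _ = away
          (λ e p → dec-false (incident? z₁ e) λ i → ⊥-elim-irr (proj₁ (proj₂ p) i))
          λ { e₁ → dec-false (z₁ FV.≟ x₁) (apart x₁∈ z₁∈ ∘ sym) ; e₂ → dec-false (z₁ FV.≟ x₂) (apart x₂∈ z₁∈ ∘ sym)
            ; e₃ → dec-false (z₁ FV.≟ x₂) (apart x₂∈ z₁∈ ∘ sym) ; e₄ → dec-false (z₁ FV.≟ x₄) (x₄≢z₁ ∘ sym)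
            ; e₅ → dec-false (z₁ FV.≟ x₅) z₁≢x₅ ; e₆ → dec-false (z₁ FV.≟ x₆) (apart x₆∈ z₁∈ ∘ sym) }
        by-vertex (no _) (yes refl) = away
          (λ e p → dec-false (incident? z₂ e) λ i → ⊥-elim-irr (proj₂ (proj₂ p) i))
          λ { e₁ → dec-false (z₂ FV.≟ x₁) (x₁≢z₂ ∘ sym) ; e₂ → dec-false (z₂ FV.≟ x₂) (x₂≢z₂ ∘ sym)
            ; e₃ → dec-false (z₂ FV.≟ x₂) (x₂≢z₂ ∘ sym) ; e₄ → dec-false (z₂ FV.≟ x₄) (apart z₂∈ x₄∈)
            ; e₅ → dec-false (z₂ FV.≟ x₅) (apart z₂∈ x₅∈) ; e₆ → dec-false (z₂ FV.≟ x₆) z₂≢x₆ }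
        by-vertex (no v≢z₁) (no v≢z₂) = trans
          (parity-cong (λ c → cong (member k c ∧_) (sym (core-inc P v′ c))) C.FE.elements)
          (xor-false (even k v′))
          where
          v′ : CoreV P
          v′ = v Refinement., [ v≢z₁ , v≢z₂ ]

      joins-inc : ∀ {e u w} → Joins e u w → ∀ v → inc v e ≡ does (v FV.≟ u) xor does (v FV.≟ w)
      joins-inc {e} j v = trans (inc-xor v e) (joins-xor j (λ u → does (v FV.≟ u)))

      M-even : ∀ k → Even (M k)
      M-even k v = begin
        parity (λ e → M k e ∧ inc v e) FE.elements
          ≡⟨ parity-cong (λ e → distrib (extend (isCoreEdge? P) E-finite (member k) e) (table E-finite (weights k) e) (inc v e)) FE.elements ⟩
        parity (λ e → (extend (isCoreEdge? P) E-finite (member k) e ∧ inc v e) xor (table E-finite (weights k) e ∧ inc v e)) FE.elements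
          ≡⟨ parity-xor _ _ FE.elements ⟩
        parity (λ e → extend (isCoreEdge? P) E-finite (member k) e ∧ inc v e) FE.elements
          xor parity (λ e → table E-finite (weights k) e ∧ inc v e) FE.elements
          ≡⟨ cong₂ _xor_ (core-part k v) (parity-table E-finite (weights k) (inc v)) ⟩
        parity (λ j → is k j ∧ at v j) halfEdges xor parity (λ (e , c) → c ∧ inc v e) (weights k)
          ≡⟨ cong (parity (λ j → is k j ∧ at v j) halfEdges xor_) ends-of-special ⟩
        parity (λ j → is k j ∧ at v j) halfEdges xor parity-of-ends
          ≡⟨ balance {is k e₁} {is k e₂} {is k e₃} {is k e₄} {is k e₅} {is k e₆} {is k t} colours (colour-parity k) X₁ X₂ X₄ X₅ X₆ Z₁ Z₂ ⟩
        false ∎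
        where
        open ≡-Reasoning
        distrib : ∀ a b c → (a xor b) ∧ c ≡ (a ∧ c) xor (b ∧ c)
        distrib a b c = Bool.∧-distribʳ-xor c a b
        X₁ X₂ X₄ X₅ X₆ Z₁ Z₂ parity-of-ends : Bool
        X₁ = does (v FV.≟ x₁)
        X₂ = does (v FV.≟ x₂)
        X₄ = does (v FV.≟ x₄)
        X₅ = does (v FV.≟ x₅)
        X₆ = does (v FV.≟ x₆)
        Z₁ = does (v FV.≟ z₁)
        Z₂ = does (v FV.≟ z₂)
        parity-of-ends = (is k e₁ ∧ (X₁ xor X₂)) xor (is k t ∧ (X₂ xor Z₂)) xor (is k e₆ ∧ (Z₂ xor X₆))
          xor (is k e₄ ∧ (X₄ xor Z₁)) xor (is k e₅ ∧ (Z₁ xor X₅)) xor ((is k t xor is k e₆) ∧ (Z₁ xor Z₂)) xor false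
        ends-of-special : parity (λ (e , c) → c ∧ inc v e) (weights k) ≡ parity-of-ends
        ends-of-special =
          cong₂ _xor_ (cong (is k e₁ ∧_) (joins-inc x₁x₂-joins v))
          (cong₂ _xor_ (cong (is k t ∧_) (joins-inc joins-x₂z₂ v))
          (cong₂ _xor_ (cong (is k e₆ ∧_) (joins-inc joins-z₂x₆ v))
          (cong₂ _xor_ (cong (is k e₄ ∧_) (joins-inc joins-x₄z₁ v))
          (cong₂ _xor_ (cong (is k e₅ ∧_) (joins-inc joins-z₁x₅ v))
          (cong₂ _xor_ (cong ((is k t xor is k e₆) ∧_) (joins-inc joins-z₁z₂ v)) (refl {x = false}))))))
        colours : (is k e₁ ≡ is k e₂ × is k t ≡ is k e₃) ⊎ (is k e₁ ≡ is k e₃ × is k t ≡ is k e₂)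
        colours = Sum.map (λ { (refl , refl) → cong (λ c → does (k Fin.≟ c)) c₁≡cₛ , refl })
          (λ { (refl , refl) → cong (λ c → does (k Fin.≟ c)) c₁≡cₛ , refl }) st

      not-both : ∀ k → is k t ∧ is k e₆ ≡ false
      not-both k = ≢true⇒≡false λ p → let a , b = ∧-true {is k t} p in
        cₜ≢c₆ (trans (sym (does-sound (k Fin.≟ colour t) a)) (does-sound (k Fin.≟ colour e₆) b))

      M-count : ∀ e → card (λ k → M k e) (allFin n) ≡ multiplicity (es F e)
      M-count e with core-or-special e
      ... | inj₁ p = trans (card-cong (λ k → M-core k (e Refinement., [ p ])) (allFin n)) (covers (e Refinement., [ p ]))
      ... | inj₂ e∈ = at-special e∈
        where
        on-F : ∀ {e} j → es F e ≡ true → (∀ k → M k e ≡ is k j) → card (λ k → M k e) (allFin n) ≡ multiplicity (es F e)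
        on-F {e} j e∈F eq = trans (card-cong eq (allFin n)) (trans (card-singleton (Fin-finite n) (colour j)) (cong multiplicity (sym e∈F)))
        at-special : ∀ {e} → e ∈ special → card (λ k → M k e) (allFin n) ≡ multiplicity (es F e)
        at-special (here refl) = on-F e₁ (F⁺ (inj₁ x₁x₂∈C₁)) λ k → M-special k (here refl)
        at-special (there (here refl)) = on-F t (F⁺ (inj₁ (proj₁ (proj₂ x₂z₂∈C₁)))) λ k → M-special k (there (here refl))
        at-special (there (there (here refl))) =
          on-F e₆ (F⁺ (inj₁ (proj₁ (proj₂ z₂x₆∈C₁)))) λ k → M-special k (there (there (here refl)))
        at-special (there (there (there (here refl)))) =
          on-F e₄ (F⁺ (inj₂ (proj₁ (proj₂ x₄z₁∈C₂)))) λ k → M-special k (there (there (there (here refl))))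
        at-special (there (there (there (there (here refl))))) =
          on-F e₅ (F⁺ (inj₂ (proj₁ (proj₂ z₁x₅∈C₂)))) λ k → M-special k (there (there (there (there (here refl)))))
        -- Here `cₜ≢c₆` is decisive: the two members passing through z₂ are different, so z₁z₂ lies
        -- in both of them; with one and the same member it would lie in none.
        at-special (there (there (there (there (there (here refl)))))) = begin
          card (λ k → M k z₁z₂′) (allFin n)
            ≡⟨ card-cong (λ k → trans (M-special k (there (there (there (there (there (here refl)))))))
                 (xor≡∨ (is k t) (is k e₆) (not-both k))) (allFin n) ⟩
          card (λ k → is k t ∨ is k e₆) (allFin n)
            ≡⟨ ℕ.+-identityʳ _ ⟨
          card (λ k → is k t ∨ is k e₆) (allFin n) + 0
            ≡⟨ cong (card (λ k → is k t ∨ is k e₆) (allFin n) +_) (card-none not-both (allFin n)) ⟨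
          card (λ k → is k t ∨ is k e₆) (allFin n) + card (λ k → is k t ∧ is k e₆) (allFin n)
            ≡⟨ card-∨-∧ (λ k → is k t) (λ k → is k e₆) (allFin n) ⟩
          card (λ k → is k t) (allFin n) + card (λ k → is k e₆) (allFin n)
            ≡⟨ cong₂ _+_ (card-singleton (Fin-finite n) (colour t)) (card-singleton (Fin-finite n) (colour e₆)) ⟩
          2
            ≡⟨ cong multiplicity z₁z₂∉F ⟨
          multiplicity (es F z₁z₂′) ∎
          where
          open ≡-Reasoning
          xor≡∨ : ∀ a b → a ∧ b ≡ false → a xor b ≡ a ∨ b
          xor≡∨ true  false _ = refl
          xor≡∨ false _     _ = refl

      nonempty : Fin n → Bool
      nonempty k = any (M k) FE.elements

      -- Several members may become the empty edge set, but a CDC has no repetitions; hence the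
      -- empty ones are left out.
      members : List (Fin n)
      members = filterᵇ nonempty (allFin n)

      cycle : Fin n → Subgraph Q
      cycle k = edgeInduced Q (M k)

      -- F contains x₂z₂ and misses z₁z₂. A member doing the same would be the one of colour t and,
      -- having even degree at z₂, also that of `e₆`.
      F≉cycle : ∀ k → ¬ (F ≈ cycle k)
      F≉cycle k F≈ = cₜ≢c₆ (trans (sym k≡cₜ) k≡c₆)
        where
        k≡cₜ : k ≡ colour t
        k≡cₜ = does-sound (k Fin.≟ colour t) (trans (sym (M-special k (there (here refl))))
          (trans (sym (proj₂ F≈ x₂z₂)) (F⁺ (inj₁ (proj₁ (proj₂ x₂z₂∈C₁))))))
        k≡c₆ : k ≡ colour e₆
        k≡c₆ = does-sound (k Fin.≟ colour e₆) (trans (sym (xor-false (trans (sym (M-special k (there (there (there (there (there (here refl))))))))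
          (trans (sym (proj₂ F≈ z₁z₂′)) z₁z₂∉F)))) (dec-true (k Fin.≟ colour t) k≡cₜ))

      -- A nonempty even set in a cubic graph meets the 2-factor F, and an edge of F lies in one
      -- member only.
      cycle-injective : ∀ j k → nonempty j ≡ true → cycle j ≈ cycle k → j ≡ k
      cycle-injective j k ne j≈k = share (find (Any.any⁻ (M j) FE.elements (true≡ ne)))
        where
        same : (∃ λ f → M j f ≡ true × es F f ≡ true) → j ≡ k
        same (f , Mf , Ff) = card-one (Fin-finite n) {λ k → M k f} (trans (M-count f) (cong multiplicity Ff))
          (trans (sym (proj₂ j≈k f)) Mf) j Mf
        share : (∃ λ e → e ∈ FE.elements × T (M j e)) → j ≡ k
        share (e , _ , e∈) = same (even-meets-two-factor cubic (M-even j) F twoFactor (≡true e∈))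

      cdc : List (Subgraph Q)
      cdc = F ∷ map cycle members

      cdc-distinct : SetoidUnique.Unique (subgraphSetoid Q) cdc
      cdc-distinct = All.map⁺ (All.universal F≉cycle members) ∷ unique-members (Finite.unique (Fin-finite n))
        where
        unique-members : ∀ {ks} → Unique ks → SetoidUnique.Unique (subgraphSetoid Q) (map cycle (filterᵇ nonempty ks))
        unique-members [] = []
        unique-members {k ∷ ks} (k∉ ∷ u) with nonempty k in ne
        ... | false = unique-members u
        ... | true  = All.map⁺ (All.filter⁺ _ (All.map (λ k≢j k≈j → k≢j (cycle-injective k _ ne k≈j)) k∉)) ∷ unique-members u

      cdc-regular : ∀ (K : Subgraph Q) → K ∈ˢ cdc → Regular 2 K
      cdc-regular K (here K≈F) v v∈ = trans (degree-cong K F K≈F v)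
        (proj₂ twoFactor v (true≡ (trans (sym (proj₁ K≈F v)) (≡true v∈))))
      cdc-regular K (there K∈) v v∈ with find (Any.map⁻ K∈)
      ... | k , _ , K≈ = trans (degree-cong K (cycle k) K≈ v)
              (even⇒regular cubic (M-even k) v (true≡ (trans (sym (proj₁ K≈ v)) (≡true v∈))))

      cdc-double : ∀ e → length (filterᵇ (λ K → es K e) cdc) ≡ 2
      cdc-double e = trans first (once-more (es F e))
        where
        once-more : ∀ b → (if b then 1 else 0) + multiplicity b ≡ 2
        once-more true  = refl
        once-more false = refl
        M⇒nonempty : ∀ k → M k e ≡ true → nonempty k ≡ true
        M⇒nonempty k Mke = ≡true (Any.any⁺ (M k) (lose (FE.complete e) (true≡ Mke)))
        rest : length (filterᵇ (λ K → es K e) (map cycle members)) ≡ multiplicity (es F e)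
        rest = trans (card-map (λ K → es K e) cycle members) (trans (card-filter M⇒nonempty (allFin n)) (M-count e))
        first : length (filterᵇ (λ K → es K e) cdc) ≡ (if es F e then 1 else 0) + multiplicity (es F e)
        first rewrite sym rest with es F e
        ... | true  = refl
        ... | false = refl

    completes : ∃ λ S → IsCDC S × F ∈ˢ S
    completes = cdc , record
      { distinct = cdc-distinct
      ; circuits = λ {K} K∈ → regular⇒circuits K (cdc-regular K K∈)
      ; double   = cdc-double
      } , here ((λ _ → refl) , (λ _ → refl))

-- Colours around the cycle Q¹, Q², Q³, Q⁴

-- Colours of the half-edges of a piece: r and s of those glued to the previous
-- piece, r′ and s′ of those glued to the next one, t of the one at a pole, and l
-- of e₆.

record Link {n : ℕ} (r s t r′ s′ l : Fin n) : Set where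
  field
    s≢t     : s ≢ t
    r≡s⇒t≡l : r ≡ s → t ≡ l
    r≡t⇒s≡l : r ≡ t → s ≡ l
    even    : ∀ k → does (k Fin.≟ r) xor does (k Fin.≟ s) xor does (k Fin.≟ t)
                xor does (k Fin.≟ r′) xor does (k Fin.≟ s′) xor does (k Fin.≟ l) ≡ false

  private
    -- Two equal pairs drop out of the parity; evaluated at the colour r′, what is left says that s′
    -- is this colour as well.
    cancel : ∀ {a b c} → a ≡ b → c ≡ l → (∀ k → does (k Fin.≟ a) xor does (k Fin.≟ b) xor does (k Fin.≟ c)
                xor does (k Fin.≟ r′) xor does (k Fin.≟ s′) xor does (k Fin.≟ l) ≡ false) → r′ ≡ s′
    cancel {a} refl refl even = does-sound (r′ Fin.≟ s′) (trans (sym (xor-false (trans (sym rearrange) (even r′)))) (dec-true (r′ Fin.≟ r′) refl))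
      where
      open xor-∧-Solver
      rearrange = solve 4 (λ a c r s → a :+ (a :+ (c :+ (r :+ (s :+ c)))) := r :+ s) refl
        (does (r′ Fin.≟ a)) (does (r′ Fin.≟ l)) (does (r′ Fin.≟ r′)) (does (r′ Fin.≟ s′))

  r≡s⇒r′≡s′ : r ≡ s → r′ ≡ s′
  r≡s⇒r′≡s′ r≡s = cancel r≡s (r≡s⇒t≡l r≡s) even

  r≡t⇒r′≡s′ : r ≡ t → r′ ≡ s′
  r≡t⇒r′≡s′ r≡t = cancel r≡t (r≡t⇒s≡l r≡t) λ k → trans
    (solve 6 (λ r s t r′ s′ l → r :+ (t :+ (s :+ (r′ :+ (s′ :+ l)))) := r :+ (s :+ (t :+ (r′ :+ (s′ :+ l))))) refl
      (does (k Fin.≟ r)) (does (k Fin.≟ s)) (does (k Fin.≟ t)) (does (k Fin.≟ r′)) (does (k Fin.≟ s′)) (does (k Fin.≟ l)))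
    (even k)
    where open xor-∧-Solver

  -- Evaluated at the colour t, the parity asks for another half-edge of this colour, and l is the
  -- only one left.
  t≡l : r ≢ t → t ≢ r′ → t ≢ s′ → t ≡ l
  t≡l r≢t t≢r′ t≢s′ with even t
  ... | eq rewrite dec-false (t Fin.≟ r) (r≢t ∘ sym) | dec-false (t Fin.≟ s) (s≢t ∘ sym) | dec-true (t Fin.≟ t) refl
                 | dec-false (t Fin.≟ r′) t≢r′ | dec-false (t Fin.≟ s′) t≢s′
    = does-sound (t Fin.≟ l) (sym (xor-false eq))

module _ {n : ℕ} {r₁ r₂ r₃ r₄ s₁ s₂ s₃ s₄ t₁ t₂ t₃ t₄ l m : Fin n}
         (L₁ : Link r₁ s₁ t₁ r₂ s₂ l) (L₂ : Link r₂ s₂ t₂ r₃ s₃ m)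
         (L₃ : Link r₃ s₃ t₃ r₄ s₄ l) (L₄ : Link r₄ s₄ t₄ r₁ s₁ m) (t₁≢t₃ : t₁ ≢ t₃) where
  private
    module L₁ = Link L₁
    module L₂ = Link L₂
    module L₃ = Link L₃
    module L₄ = Link L₄

    -- Equality would pass from Q¹ through Q² to Q³. In Q¹ and in Q³ it forces the colour at the
    -- pole to be l, that of their common edge `e₆`, so t₁ and t₃ would agree.
    r₁≢s₁ : r₁ ≢ s₁
    r₁≢s₁ eq = t₁≢t₃ (trans (L₁.r≡s⇒t≡l eq) (sym (L₃.r≡s⇒t≡l (L₂.r≡s⇒r′≡s′ (L₁.r≡s⇒r′≡s′ eq)))))
    -- From here on the pieces are taken backwards: an equality in any of them would be handed on
    -- until it reached Q¹.
    r₄≢s₄ : r₄ ≢ s₄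
    r₄≢s₄ = r₁≢s₁ ∘ L₄.r≡s⇒r′≡s′
    r₃≢s₃ : r₃ ≢ s₃
    r₃≢s₃ = r₄≢s₄ ∘ L₃.r≡s⇒r′≡s′
    r₂≢s₂ : r₂ ≢ s₂
    r₂≢s₂ = r₃≢s₃ ∘ L₂.r≡s⇒r′≡s′
    r₁≢t₁ : r₁ ≢ t₁
    r₁≢t₁ = r₂≢s₂ ∘ L₁.r≡t⇒r′≡s′
    r₂≢t₂ : r₂ ≢ t₂
    r₂≢t₂ = r₃≢s₃ ∘ L₂.r≡t⇒r′≡s′
    r₃≢t₃ : r₃ ≢ t₃
    r₃≢t₃ = r₄≢s₄ ∘ L₃.r≡t⇒r′≡s′
    r₄≢t₄ : r₄ ≢ t₄
    r₄≢t₄ = r₁≢s₁ ∘ L₄.r≡t⇒r′≡s′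

  -- If t₁ = t₂, this colour differs from r₂ and s₂, because t₂ does so in Q²; parity in Q¹ then
  -- makes it l. Likewise t₃ = t₄ is l by parity in Q³. In the other case Q⁴ and Q² play these
  -- roles, with m in place of l.
  links-impossible : (t₁ ≡ t₂ × t₃ ≡ t₄) ⊎ (t₁ ≡ t₄ × t₃ ≡ t₂) → ⊥
  links-impossible (inj₁ (refl , refl)) = t₁≢t₃ (trans
    (L₁.t≡l r₁≢t₁ (r₂≢t₂ ∘ sym) (L₂.s≢t ∘ sym)) (sym (L₃.t≡l r₃≢t₃ (r₄≢t₄ ∘ sym) (L₄.s≢t ∘ sym))))
  links-impossible (inj₂ (refl , refl)) = t₁≢t₃ (trans
    (L₄.t≡l r₄≢t₄ (r₁≢t₁ ∘ sym) (L₁.s≢t ∘ sym)) (sym (L₂.t≡l r₂≢t₂ (r₃≢t₃ ∘ sym) (L₃.s≢t ∘ sym))))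

pairs-match : ∀ {n} {a b c d : Fin n} → a ≢ b →
  (∀ k → does (k Fin.≟ a) xor does (k Fin.≟ b) ≡ does (k Fin.≟ c) xor does (k Fin.≟ d)) →
  (a ≡ c × b ≡ d) ⊎ (a ≡ d × b ≡ c)
pairs-match {a = a} {b} {c} {d} a≢b match with one-of (trans (sym (match a)) a-once) | one-of (trans (sym (match b)) b-once)
  where
  a-once : does (a Fin.≟ a) xor does (a Fin.≟ b) ≡ true
  a-once = cong₂ _xor_ (dec-true (a Fin.≟ a) refl) (dec-false (a Fin.≟ b) a≢b)
  b-once : does (b Fin.≟ a) xor does (b Fin.≟ b) ≡ true
  b-once = cong₂ _xor_ (dec-false (b Fin.≟ a) (a≢b ∘ sym)) (dec-true (b Fin.≟ b) refl)
  one-of : ∀ {k} → does (k Fin.≟ c) xor does (k Fin.≟ d) ≡ true → k ≡ c ⊎ k ≡ d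
  one-of {k} eq with k Fin.≟ c
  ... | yes k≡c = inj₁ k≡c
  ... | no _    = inj₂ (does-sound (k Fin.≟ d) eq)
... | inj₁ a≡c | inj₂ b≡d = inj₁ (a≡c , b≡d)
... | inj₂ a≡d | inj₁ b≡c = inj₂ (a≡d , b≡c)
... | inj₁ a≡c | inj₁ b≡c = ⊥-elim (a≢b (trans a≡c (sym b≡c)))
... | inj₂ a≡d | inj₂ b≡d = ⊥-elim (a≢b (trans a≡d (sym b≡d)))

-- From a CDC of `H` to covers of the four pieces

multiplicity-rest : ∀ {m} b → (if b then 1 else 0) + m ≡ 2 → m ≡ multiplicity b
multiplicity-rest true  eq = ℕ.suc-injective eq
multiplicity-rest false eq = eq

module _ {G : Graph} where
  open Graph G
  open Subgraph

  remove : ∀ (K : Subgraph G) {S} → K ∈ˢ S → ∃ λ S′ → (∀ {L} → L ∈ S′ → L ∈ˢ S) ×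
    (∀ e → length (filterᵇ (λ L → es L e) S) ≡ (if es K e then 1 else 0) + length (filterᵇ (λ L → es L e) S′))
  remove K {L ∷ S} (here K≈L) = S , (λ L∈ → there (Any.map (λ { refl → (λ _ → refl) , (λ _ → refl) }) L∈)) , first
    where
    first : ∀ e → length (filterᵇ (λ L → es L e) (L ∷ S)) ≡ (if es K e then 1 else 0) + length (filterᵇ (λ L → es L e) S)
    first e with es L e | es K e | proj₂ K≈L e
    ... | true  | true  | _ = refl
    ... | false | false | _ = refl
  remove K {L ∷ S} (there K∈) with remove K K∈
  ... | S′ , ⊆S , rest = L ∷ S′ , (λ { (here refl) → here ((λ _ → refl) , (λ _ → refl)) ; (there L∈) → there (⊆S L∈) }) , later
    where
    later : ∀ e → length (filterᵇ (λ L → es L e) (L ∷ S)) ≡ (if es K e then 1 else 0) + length (filterᵇ (λ L → es L e) (L ∷ S′))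
    later e with es L e
    ... | true  = trans (cong ℕ.suc (rest e)) (sym (ℕ.+-suc _ _))
    ... | false = rest e

  card-lookup : ∀ (S : List (Subgraph G)) e →
    card (λ k → es (lookup S k) e) (allFin (length S)) ≡ length (filterᵇ (λ L → es L e) S)
  card-lookup S e = trans (sym (card-map (λ L → es L e) (lookup S) (allFin _)))
    (cong (length ∘ filterᵇ (λ L → es L e)) (trans (map-tabulate id (lookup S)) (tabulate-lookup S)))

module _ (Q : Fin 4 → Piece) (cubic : ∀ i → Cubic (Piece.Q (Q i)))
         (no-cdc : ∀ i → ¬ (∃ λ (S : List (Subgraph (Piece.Q (Q i)))) → IsCDC S × Piece.F (Q i) ∈ˢ S))
         {n : ℕ} (K : Fin n → Subgraph (H Q)) where
  open Subgraph
  open Graph (H Q)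
  open GraphLemmas (H Q)

  module _ (K-even : ∀ k → Even (es (K k)))
           (K-count : ∀ e → card (λ k → es (K k) e) (allFin n) ≡ multiplicity (es (FH Q) e))
           (owner : ∀ e → es (FH Q) e ≡ true → Fin n)
           (owned : ∀ e e∈F k → es (K k) e ≡ does (k Fin.≟ owner e e∈F)) where
    private
      col : Fin 4 → HalfEdge → Fin n
      col i j = owner (inj₂ (halfEdge i j)) (FH-halfEdge Q i j)

      cover-even : ∀ i k v → EvenAt (Q i) (λ e → es (K k) (coreE i e)) (λ j → does (k Fin.≟ col i j)) v
      cover-even i k v = begin
        core-parity xor parity (λ j → does (k Fin.≟ col i j) ∧ attached (Q i) v j) halfEdges
          ≡⟨ cong (core-parity xor_) (parity-cong
               (λ j → cong (_∧ attached (Q i) v j) (owned (inj₂ (halfEdge i j)) (FH-halfEdge Q i j) k)) halfEdges) ⟨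
        core-parity xor parity (λ j → es (K k) (inj₂ (halfEdge i j)) ∧ attached (Q i) v j) halfEdges
          ≡⟨ vertex-parity Q i v (es (K k)) ⟨
        parity (λ e → es (K k) e ∧ inc (coreV i v) e) FE.elements
          ≡⟨ K-even k (coreV i v) ⟩
        false ∎
        where
        open ≡-Reasoning
        core-parity : Bool
        core-parity = parity (λ e → es (K k) (coreE i e) ∧ GraphLemmas.inc (core (Q i)) v e) (Graph.FE.elements (core (Q i)))

      cover : ∀ i → Cover (Q i) n
      cover i = record
        { member = λ k e → es (K k) (coreE i e)
        ; colour = col i
        ; even   = cover-even i
        ; covers = λ e → trans (K-count (coreE i e)) (cong multiplicity (FH-core Q i e))
        }

      obstruction : ∀ i {s t} → (s ≡ e₂ × t ≡ e₃) ⊎ (s ≡ e₃ × t ≡ e₂) → col i e₁ ≡ col i s → col i t ≡ col i e₆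
      obstruction i st c₁≡cₛ = decidable-stable (_ Fin.≟ _) λ cₜ≢c₆ →
        no-cdc i (PieceLemmas.completes (Q i) (cubic i) (cover i) st c₁≡cₛ cₜ≢c₆)

      link₂ : ∀ i → Link (col i e₁) (col i e₂) (col i e₃) (col i e₄) (col i e₅) (col i e₆)
      link₂ i = record
        { s≢t     = PieceLemmas.colours-separated (Q i) (cubic i) (cover i)
        ; r≡s⇒t≡l = obstruction i (inj₁ (refl , refl))
        ; r≡t⇒s≡l = obstruction i (inj₂ (refl , refl))
        ; even    = λ k → trans (solve 6 (λ a b c d e f → a :+ (b :+ (c :+ (d :+ (e :+ f)))) := a :+ (b :+ (c :+ (d :+ (e :+ (f :+ con false)))))) refl
                      (is k e₁) (is k e₂) (is k e₃) (is k e₄) (is k e₅) (is k e₆)) (Cover.colour-parity (cover i) k)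
        }
        where
        open xor-∧-Solver
        is : Fin n → HalfEdge → Bool
        is k j = does (k Fin.≟ col i j)

      -- The version for Q¹ and Q³, where `e₂` ends at a pole and `e₃` is glued to the previous
      -- piece; in Q² and Q⁴ it is the other way round.
      link₃ : ∀ i → Link (col i e₁) (col i e₃) (col i e₂) (col i e₄) (col i e₅) (col i e₆)
      link₃ i = record
        { s≢t     = Link.s≢t (link₂ i) ∘ sym
        ; r≡s⇒t≡l = Link.r≡t⇒s≡l (link₂ i)
        ; r≡t⇒s≡l = Link.r≡s⇒t≡l (link₂ i)
        ; even    = λ k → trans (solve 4 (λ a b c d → a :+ (b :+ (c :+ d)) := a :+ (c :+ (b :+ d))) refl
                      (does (k Fin.≟ col i e₁)) (does (k Fin.≟ col i e₃)) (does (k Fin.≟ col i e₂)) _) (Link.even (link₂ i) k)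
        }
        where open xor-∧-Solver

      pole-colours : Fin 2 → Fin n × Fin n
      pole-colours pole-p = col #1 e₂ , col #3 e₂
      pole-colours pole-q = col #2 e₃ , col #4 e₃

      at-pole : ∀ {a b c : Bool} (k c₁ c₂ : Fin n) → a ≡ does (k Fin.≟ c₁) → b ≡ does (k Fin.≟ c₂) → a xor (b xor (c xor false)) ≡ false →
        does (k Fin.≟ c₁) xor does (k Fin.≟ c₂) ≡ c
      at-pole {a} {b} {c} k _ _ refl refl eq = xor-false (trans
        (solve 3 (λ a b c → (a :+ b) :+ c := a :+ (b :+ (c :+ con false))) refl a b c) eq)
        where open xor-∧-Solver

      -- Evenness at p and at q: a member passes through α exactly when it has one, but not both, of
      -- the two colours at the pole.
      pole : ∀ j k → does (k Fin.≟ proj₁ (pole-colours j)) xor does (k Fin.≟ proj₂ (pole-colours j)) ≡ es (K k) α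
      pole pole-p k = at-pole k (col #1 e₂) (col #3 e₂) (owned _ (FH-halfEdge Q #1 e₂) k) (owned _ (FH-halfEdge Q #3 e₂) k)
        (trans (sym (pole-parity Q pole-p (es (K k)))) (K-even k (poleV pole-p)))
      pole pole-q k = at-pole k (col #2 e₃) (col #4 e₃) (owned _ (FH-halfEdge Q #2 e₃) k) (owned _ (FH-halfEdge Q #4 e₃) k)
        (trans (sym (pole-parity Q pole-q (es (K k)))) (K-even k (poleV pole-q)))

      poles-differ : col #1 e₂ ≢ col #3 e₂
      poles-differ eq = ℕ.0≢1+n (trans (sym (card-none α∉ (allFin n))) (K-count α))
        where
        α∉ : ∀ k → es (K k) α ≡ false
        α∉ k = trans (sym (pole pole-p k)) (trans (cong (λ c → does (k Fin.≟ col #1 e₂) xor does (k Fin.≟ c)) (sym eq)) (Bool.xor-same (does (k Fin.≟ col #1 e₂))))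

    no-cover : ⊥
    -- The four links share their r, s and l by computation, both labels of a glued edge naming the
    -- same connector. The pairs of colours at p and at q match since both describe the members
    -- through α.
    no-cover = links-impossible (link₃ #1) (link₂ #2) (link₃ #3) (link₂ #4) poles-differ
      (pairs-match poles-differ λ k → trans (pole pole-p k) (sym (pole pole-q k)))

theorem2p16 : (Q : Fin 4 → Piece) →
    (∀ i → IsPermutationSnark (Piece.Q (Q i))) →
    (∀ i → CyclicallyEdgeConnected (Piece.Q (Q i)) 5) →
    (∀ i → ¬ (∃ λ (S : List (Subgraph (Piece.Q (Q i)))) → IsCDC S × Piece.F (Q i) ∈ˢ S)) →
    (S : List (Subgraph (H Q))) →
    IsCDC S →
    ¬ (FH Q ∈ˢ S)
theorem2p16 Q snark _ no-cdc S isCDC F∈S = impossible (remove (FH Q) F∈S)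
  where
  open Subgraph
  open Graph (H Q)
  open GraphLemmas (H Q)

  impossible : (∃ λ S′ → (∀ {L} → L ∈ S′ → L ∈ˢ S) ×
    (∀ e → length (filterᵇ (λ L → es L e) S) ≡ (if es (FH Q) e then 1 else 0) + length (filterᵇ (λ L → es L e) S′))) → ⊥
  impossible (S′ , ⊆S , counts) = no-cover Q (λ i → proj₁ (proj₁ (snark i))) no-cdc K K-even K-count
    (λ e e∈F → proj₁ (owner e e∈F)) owned
    where
    n = length S′

    K : Fin n → Subgraph (H Q)
    K = lookup S′

    K-even : ∀ k → Even (es (K k))
    K-even k = regular⇒even (K k) (circuits⇒regular (K k) (IsCDC.circuits isCDC {K k} (⊆S (∈-lookup {xs = S′} k))))

    K-count : ∀ e → card (λ k → es (K k) e) (allFin n) ≡ multiplicity (es (FH Q) e)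
    K-count e = trans (card-lookup S′ e)
      (multiplicity-rest (es (FH Q) e) (trans (sym (counts e)) (IsCDC.double isCDC e)))

    once : ∀ e → es (FH Q) e ≡ true → card (λ k → es (K k) e) (allFin n) ≡ 1
    once e e∈F = trans (K-count e) (cong multiplicity e∈F)

    owner : ∀ e → es (FH Q) e ≡ true → ∃ λ k → es (K k) e ≡ true
    owner e e∈F = card-witness _ (allFin n) (subst (1 ≤_) (sym (once e e∈F)) (s≤s z≤n))

    owned : ∀ e e∈F k → es (K k) e ≡ does (k Fin.≟ proj₁ (owner e e∈F))
    owned e e∈F k = indicator k (owner e e∈F)
      where
      -- The owner is generalised to a variable, so that the equation k ≡ o can be matched with
      -- `refl`.
      indicator : ∀ k (o : ∃ λ k → es (K k) e ≡ true) → es (K k) e ≡ does (k Fin.≟ proj₁ o)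
      indicator k (o , o∈) with k Fin.≟ o
      ... | yes refl = o∈
      ... | no k≢o   = ≢true⇒≡false λ k∈ → k≢o (card-one (Fin-finite n) {λ k → es (K k) e} (once e e∈F) o∈ k k∈)
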